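{- Let $G$ and $H$ be two finite groups, and let $F\colon G\to H$ be a perfect nonlinear function. Then for every $\beta\in H$ the following inequality holds: $$\frac{|G|}{|H|}-\sqrt{|G|}+\frac{\sqrt{|G|}}{|H|}\le |F^{ -1}(\beta)|\le \frac{|G|}{|H|}+\sqrt{|G|}-\frac{\sqrt{|G|}}{|H|}.$$ 1. If $|F^{ -1}(\alpha)|=\frac{|G|}{|H|}-\sqrt{|G|}+\frac{\sqrt{|G|}}{|H|}$, then $|F^{ -1}(\beta)|=\frac{|G|}{|H|}+\frac{\sqrt{|G|}}{|H|}$ for each $\beta\neq\alpha$. 2. If $|F^{ -1}(\alpha)|=\frac{|G|}{|H|}+\sqrt{|G|}-\frac{\sqrt{|G|}}{|H|}$, then $|F^{ -1}(\beta)|=\frac{|G|}{|H|}-\frac{\sqrt{|G|}}{|H|}$ for each $\beta\neq\alpha$. If equality takes place, then $|H|$ divides $\sqrt{|G|}$, and consequently $|G|$ is a square.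
   Context: Groups are written additively. A function $F\colon G\to H$ between finite groups is perfect nonlinear if $|\{x\in G: F(x+a)-F(x)=b\}|=|G|/|H|$ for all $a\in G\setminus\{0\}$ and all $b\in H$. $F^{ -1}(\beta)$ denotes the preimage set of $\beta\in H$. "Equality takes place" means that one of the two bounds is attained by some element of $H$.
   Formalization: The last assertion (if equality takes place, |H| divides √|G| and |G| is a square) is stated for |G|>1 and |H|>1; it fails for |H|=1, |G|=2 (2 is not a square) and for |G|=1, |H|=2 (2 does not divide 1). -}

module Defs where

open import Algebra.Bundles using (Group)
open import Data.Fin.Base using (Fin)
import Data.Fin.Properties as Fin
import Data.Integer.Base as ℤ
import Data.Integer.Properties as ℤ
import Data.Integer.Solver as ℤ
open import Data.Nat.Base as ℕ using (ℕ; zero; suc; NonZero)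
import Data.Nat.Properties as ℕ
import Data.Nat.Solver as ℕ
open import Data.Product.Base using (∃; _,_)
open import Data.Rational.Base as ℚ using (ℚ; 0ℚ; 1ℚ; ½; mkℚ; toℚᵘ)
import Data.Rational.Properties as ℚ
import Data.Rational.Solver as ℚ
import Data.Rational.Unnormalised.Base as ℚᵘ
import Data.Rational.Unnormalised.Properties as ℚᵘ
open import Data.Sum.Base using (inj₁; inj₂)
open import Data.Vec.Base using (count; tabulate)
open import Function.Bundles using (Func; Inverse)
open import Function.Properties.Inverse using (Inverse⇒Injection)
open import Level using (_⊔_) renaming (suc to lsuc)
open import Relation.Binary.Definitions using (Decidable)
open import Relation.Binary.PropositionalEquality as ≡ using (_≡_; refl; cong)
open import Relation.Nullary using (¬_; yes; no)
open import Relation.Nullary.Decidable using (via-injection)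
import Relation.Unary as U

------------------------------------------------------------------------
-- Real numbers as Cauchy sequences of rationals

record ℝ : Set where
  constructor mkℝ
  field
    seq    : ℕ → ℚ
    cauchy : ∀ ε → 0ℚ ℚ.< ε → ∃ λ N → ∀ m n → N ℕ.≤ m → N ℕ.≤ n →
             ℚ.∣ seq m ℚ.- seq n ∣ ℚ.< ε

open ℝ public

infix 4 _≃ᵣ_ _≤ᵣ_

-- The difference tends to 0.
_≃ᵣ_ : ℝ → ℝ → Set
x ≃ᵣ y = ∀ ε → 0ℚ ℚ.< ε → ∃ λ N → ∀ n → N ℕ.≤ n →
         ℚ.∣ seq x n ℚ.- seq y n ∣ ℚ.< ε

-- The slack ε is needed: equal reals may have representing sequences that
-- are nowhere ordered termwise.
_≤ᵣ_ : ℝ → ℝ → Set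
x ≤ᵣ y = ∀ ε → 0ℚ ℚ.< ε → ∃ λ N → ∀ n → N ℕ.≤ n →
         seq x n ℚ.≤ seq y n ℚ.+ ε

fromℚ : ℚ → ℝ
fromℚ q = mkℝ (λ _ → q) λ ε 0<ε → 0 , λ _ _ _ _ →
  ≡.subst (λ r → ℚ.∣ r ∣ ℚ.< ε) (≡.sym (ℚ.+-inverseʳ q)) 0<ε

fromℕ : ℕ → ℝ
fromℕ n = fromℚ (ℤ.+ n ℚ./ 1)

private
  half-sum : ∀ ε → ε ℚ.* ½ ℚ.+ ε ℚ.* ½ ≡ ε
  half-sum ε = ≡.trans (≡.sym (ℚ.*-distribˡ-+ ε ½ ½)) (ℚ.*-identityʳ ε)

  0<*½ : ∀ {ε} → 0ℚ ℚ.< ε → 0ℚ ℚ.< ε ℚ.* ½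
  0<*½ 0<ε = ℚ.*-monoˡ-<-pos ½ 0<ε

  interchange : ∀ a b c d → (a ℚ.+ b) ℚ.- (c ℚ.+ d) ≡ (a ℚ.- c) ℚ.+ (b ℚ.- d)
  interchange = solve 4 (λ a b c d →
    (a :+ b) :- (c :+ d) := (a :- c) :+ (b :- d)) refl
    where open ℚ.+-*-Solver

  neg-diff : ∀ a b → (ℚ.- a) ℚ.- (ℚ.- b) ≡ ℚ.- (a ℚ.- b)
  neg-diff = solve 2 (λ a b → (:- a) :- (:- b) := :- (a :- b)) refl
    where open ℚ.+-*-Solver

  *-diff : ∀ a b c → a ℚ.* c ℚ.- b ℚ.* c ≡ (a ℚ.- b) ℚ.* c
  *-diff = solve 3 (λ a b c → a :* c :- b :* c := (a :- b) :* c) refl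
    where open ℚ.+-*-Solver

infixl 6 _+ᵣ_ _-ᵣ_
infixl 7 _/ᵣ_
infix  8 -ᵣ_

_+ᵣ_ : ℝ → ℝ → ℝ
x +ᵣ y = mkℝ (λ n → seq x n ℚ.+ seq y n) λ ε 0<ε →
  let N₁ , p = cauchy x (ε ℚ.* ½) (0<*½ 0<ε)
      N₂ , q = cauchy y (ε ℚ.* ½) (0<*½ 0<ε)
  in N₁ ℕ.⊔ N₂ , λ m n N≤m N≤n → begin-strict
    ℚ.∣ (seq x m ℚ.+ seq y m) ℚ.- (seq x n ℚ.+ seq y n) ∣
      ≡⟨ cong ℚ.∣_∣ (interchange (seq x m) (seq y m) (seq x n) (seq y n)) ⟩
    ℚ.∣ (seq x m ℚ.- seq x n) ℚ.+ (seq y m ℚ.- seq y n) ∣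
      ≤⟨ ℚ.∣p+q∣≤∣p∣+∣q∣ (seq x m ℚ.- seq x n) (seq y m ℚ.- seq y n) ⟩
    ℚ.∣ seq x m ℚ.- seq x n ∣ ℚ.+ ℚ.∣ seq y m ℚ.- seq y n ∣
      <⟨ ℚ.+-mono-< (p m n (ℕ.m⊔n≤o⇒m≤o N₁ N₂ N≤m) (ℕ.m⊔n≤o⇒m≤o N₁ N₂ N≤n))
                    (q m n (ℕ.m⊔n≤o⇒n≤o N₁ N₂ N≤m) (ℕ.m⊔n≤o⇒n≤o N₁ N₂ N≤n)) ⟩
    ε ℚ.* ½ ℚ.+ ε ℚ.* ½
      ≡⟨ half-sum ε ⟩
    ε ∎
  where open ℚ.≤-Reasoning

-ᵣ_ : ℝ → ℝ
-ᵣ x = mkℝ (λ n → ℚ.- seq x n) λ ε 0<ε →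
  let N , p = cauchy x ε 0<ε
  in N , λ m n N≤m N≤n → begin-strict
    ℚ.∣ (ℚ.- seq x m) ℚ.- (ℚ.- seq x n) ∣  ≡⟨ cong ℚ.∣_∣ (neg-diff (seq x m) (seq x n)) ⟩
    ℚ.∣ ℚ.- (seq x m ℚ.- seq x n) ∣        ≡⟨ ℚ.∣-p∣≡∣p∣ (seq x m ℚ.- seq x n) ⟩
    ℚ.∣ seq x m ℚ.- seq x n ∣              <⟨ p m n N≤m N≤n ⟩
    ε                                      ∎
  where open ℚ.≤-Reasoning

_-ᵣ_ : ℝ → ℝ → ℝ
x -ᵣ y = x +ᵣ (-ᵣ y)

private
  ∣1/d∣≤1 : ∀ d .{{_ : NonZero d}} → ℚ.∣ ℤ.+ 1 ℚ./ d ∣ ℚ.≤ 1ℚ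
  ∣1/d∣≤1 d@(suc _) = ≡.subst (ℚ._≤ 1ℚ)
    (≡.sym (ℚ.0≤p⇒∣p∣≡p (ℚ.nonNegative⁻¹ (ℤ.+ 1 ℚ./ d) {{ℚ.normalize-nonNeg 1 d}})))
    (ℚ.toℚᵘ-cancel-≤ (ℚᵘ.≤-respˡ-≃ (ℚᵘ.≃-sym (ℚ.toℚᵘ-fromℚᵘ (ℤ.+ 1 ℚᵘ./ d)))
      (ℚᵘ.*≤* (ℤ.+≤+ (ℕ.s≤s ℕ.z≤n)))))

_/ᵣ_ : ℝ → (d : ℕ) .{{_ : NonZero d}} → ℝ
x /ᵣ d = mkℝ (λ n → seq x n ℚ.* c) λ ε 0<ε →
  let N , p = cauchy x ε 0<ε
  in N , λ m n N≤m N≤n → begin-strict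
    ℚ.∣ seq x m ℚ.* c ℚ.- seq x n ℚ.* c ∣      ≡⟨ cong ℚ.∣_∣ (*-diff (seq x m) (seq x n) c) ⟩
    ℚ.∣ (seq x m ℚ.- seq x n) ℚ.* c ∣          ≡⟨ ℚ.∣p*q∣≡∣p∣*∣q∣ (seq x m ℚ.- seq x n) c ⟩
    ℚ.∣ seq x m ℚ.- seq x n ∣ ℚ.* ℚ.∣ c ∣      ≤⟨ ℚ.*-monoˡ-≤-nonNeg ℚ.∣ seq x m ℚ.- seq x n ∣
                                                    {{ℚ.∣-∣-nonNeg (seq x m ℚ.- seq x n)}} (∣1/d∣≤1 d) ⟩
    ℚ.∣ seq x m ℚ.- seq x n ∣ ℚ.* 1ℚ           ≡⟨ ℚ.*-identityʳ _ ⟩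
    ℚ.∣ seq x m ℚ.- seq x n ∣                  <⟨ p m n N≤m N≤n ⟩
    ε                                          ∎
  where
  open ℚ.≤-Reasoning
  c : ℚ
  c = ℤ.+ 1 ℚ./ d

------------------------------------------------------------------------
-- Square roots of natural numbers

isqrt : ℕ → ℕ
isqrt zero    = 0
isqrt (suc n) with suc (isqrt n) ℕ.* suc (isqrt n) ℕ.≤? suc n
... | yes _ = suc (isqrt n)
... | no  _ = isqrt n

isqrt-lower : ∀ n → isqrt n ℕ.* isqrt n ℕ.≤ n
isqrt-lower zero    = ℕ.z≤n
isqrt-lower (suc n) with suc (isqrt n) ℕ.* suc (isqrt n) ℕ.≤? suc n
... | yes p = p
... | no  _ = ℕ.m≤n⇒m≤1+n (isqrt-lower n)

isqrt-upper : ∀ n → n ℕ.< suc (isqrt n) ℕ.* suc (isqrt n)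
isqrt-upper zero    = ℕ.s≤s ℕ.z≤n
isqrt-upper (suc n) with suc (isqrt n) ℕ.* suc (isqrt n) ℕ.≤? suc n
... | yes _ = ℕ.≤-<-trans (isqrt-upper n)
                (ℕ.*-mono-< (ℕ.n<1+n (suc (isqrt n))) (ℕ.n<1+n (suc (isqrt n))))
... | no ¬p = ℕ.≰⇒> ¬p

-- ⌊ √(n k²) ⌋ / k with k = m + 1, which lies within 1/k of √n.
√-seq : ℕ → ℕ → ℚ
√-seq n m = ℤ.+ isqrt (n ℕ.* (suc m ℕ.* suc m)) ℚ./ suc m

√-cross : ∀ n j k → isqrt (n ℕ.* (j ℕ.* j)) ℕ.* k ℕ.≤ suc (isqrt (n ℕ.* (k ℕ.* k))) ℕ.* j
√-cross n j k = ℕ.≮⇒≥ λ lt → ℕ.<-irrefl refl (begin-strict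
  (b ℕ.* j) ℕ.* (b ℕ.* j)              <⟨ ℕ.*-mono-< lt lt ⟩
  (a ℕ.* k) ℕ.* (a ℕ.* k)              ≡⟨ shuffle a k ⟩
  (a ℕ.* a) ℕ.* (k ℕ.* k)              ≤⟨ ℕ.*-monoˡ-≤ (k ℕ.* k) (isqrt-lower (n ℕ.* (j ℕ.* j))) ⟩
  (n ℕ.* (j ℕ.* j)) ℕ.* (k ℕ.* k)      ≡⟨ swap n (j ℕ.* j) (k ℕ.* k) ⟩
  (n ℕ.* (k ℕ.* k)) ℕ.* (j ℕ.* j)      ≤⟨ ℕ.*-monoˡ-≤ (j ℕ.* j) (ℕ.<⇒≤ (isqrt-upper (n ℕ.* (k ℕ.* k)))) ⟩
  (b ℕ.* b) ℕ.* (j ℕ.* j)              ≡⟨ shuffle b j ⟨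
  (b ℕ.* j) ℕ.* (b ℕ.* j)              ∎)
  where
  open ℕ.≤-Reasoning
  open ℕ.+-*-Solver
  a b : ℕ
  a = isqrt (n ℕ.* (j ℕ.* j))
  b = suc (isqrt (n ℕ.* (k ℕ.* k)))
  shuffle : ∀ x y → (x ℕ.* y) ℕ.* (x ℕ.* y) ≡ (x ℕ.* x) ℕ.* (y ℕ.* y)
  shuffle = solve 2 (λ x y → (x :* y) :* (x :* y) := (x :* x) :* (y :* y)) refl
  swap : ∀ x y z → (x ℕ.* y) ℕ.* z ≡ (x ℕ.* z) ℕ.* y
  swap = solve 3 (λ x y z → (x :* y) :* z := (x :* z) :* y) refl

√-step : ∀ n i j → √-seq n i ℚ.≤ √-seq n j ℚ.+ ℤ.+ 1 ℚ./ suc j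
√-step n i j = ℚ.toℚᵘ-cancel-≤ (begin
  toℚᵘ (ℤ.+ a ℚ./ suc i)                               ≃⟨ ℚ.toℚᵘ-fromℚᵘ (ℤ.+ a ℚᵘ./ suc i) ⟩
  ℤ.+ a ℚᵘ./ suc i                                     ≤⟨ ℚᵘ.*≤* ineq ⟩
  ℤ.+ suc b ℚᵘ./ suc j                                 ≃⟨ ℚᵘ.*≡* eq ⟩
  ℤ.+ b ℚᵘ./ suc j ℚᵘ.+ ℤ.+ 1 ℚᵘ./ suc j               ≃⟨ ℚᵘ.+-cong (ℚ.toℚᵘ-fromℚᵘ (ℤ.+ b ℚᵘ./ suc j)) (ℚ.toℚᵘ-fromℚᵘ (ℤ.+ 1 ℚᵘ./ suc j)) ⟨
  toℚᵘ (√-seq n j) ℚᵘ.+ toℚᵘ (ℤ.+ 1 ℚ./ suc j)         ≃⟨ ℚ.toℚᵘ-homo-+ (√-seq n j) (ℤ.+ 1 ℚ./ suc j) ⟨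
  toℚᵘ (√-seq n j ℚ.+ ℤ.+ 1 ℚ./ suc j)                 ∎)
  where
  open ℚᵘ.≤-Reasoning
  a b : ℕ
  a = isqrt (n ℕ.* (suc i ℕ.* suc i))
  b = isqrt (n ℕ.* (suc j ℕ.* suc j))
  ineq : ℤ.+ a ℤ.* ℤ.+ suc j ℤ.≤ ℤ.+ suc b ℤ.* ℤ.+ suc i
  ineq = ≡.subst₂ ℤ._≤_ (ℤ.pos-* a (suc j)) (ℤ.pos-* (suc b) (suc i))
           (ℤ.+≤+ (√-cross n (suc i) (suc j)))
  eq : ℤ.+ suc b ℤ.* ℤ.+ (suc j ℕ.* suc j) ≡
       (ℤ.+ b ℤ.* ℤ.+ suc j ℤ.+ ℤ.+ 1 ℤ.* ℤ.+ suc j) ℤ.* ℤ.+ suc j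
  eq = ≡.trans
    (≡.cong₂ ℤ._*_ (≡.trans (cong ℤ.+_ (ℕ.+-comm 1 b)) (ℤ.pos-+ b 1)) (ℤ.pos-* (suc j) (suc j)))
    (solve 2 (λ x y → (x :+ con (ℤ.+ 1)) :* (y :* y) := (x :* y :+ con (ℤ.+ 1) :* y) :* y)
      refl (ℤ.+ b) (ℤ.+ suc j))
    where open ℤ.+-*-Solver

√-diff : ∀ n i j → √-seq n i ℚ.- √-seq n j ℚ.≤ ℤ.+ 1 ℚ./ suc j
√-diff n i j = begin
  x ℚ.- y               ≤⟨ ℚ.+-monoˡ-≤ (ℚ.- y) (√-step n i j) ⟩
  (y ℚ.+ z) ℚ.- y       ≡⟨ solve 2 (λ y z → (y :+ z) :- y := z) refl y z ⟩
  z                     ∎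
  where
  open ℚ.≤-Reasoning
  open ℚ.+-*-Solver
  x y z : ℚ
  x = √-seq n i
  y = √-seq n j
  z = ℤ.+ 1 ℚ./ suc j

archimedean : ∀ ε → 0ℚ ℚ.< ε → ∃ λ N → ∀ n → N ℕ.≤ n → ℤ.+ 1 ℚ./ suc n ℚ.< ε
archimedean (mkℚ (ℤ.+ zero) d _) (ℚ.*<* (ℤ.+<+ ()))
archimedean (mkℚ ℤ.-[1+ _ ] d _) (ℚ.*<* ())
archimedean (mkℚ (ℤ.+ suc p) d _) _ = suc d , λ n d<n →
  ℚ.toℚᵘ-cancel-< (ℚᵘ.<-respˡ-≃ (ℚᵘ.≃-sym (ℚ.toℚᵘ-fromℚᵘ (ℤ.+ 1 ℚᵘ./ suc n)))
    (ℚᵘ.*<* (ℤ.+<+ (bound n d<n))))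
  where
  open ℕ.≤-Reasoning
  bound : ∀ n → suc d ℕ.≤ n → 1 ℕ.* suc d ℕ.< suc p ℕ.* suc n
  bound n d<n = begin-strict
    1 ℕ.* suc d        ≡⟨ ℕ.*-identityˡ (suc d) ⟩
    suc d              <⟨ ℕ.s≤s d<n ⟩
    suc n              ≤⟨ ℕ.m≤m+n (suc n) (p ℕ.* suc n) ⟩
    suc p ℕ.* suc n    ∎

√ : ℕ → ℝ
√ n = mkℝ (√-seq n) λ ε 0<ε →
  let N , small = archimedean ε 0<ε
  in N , λ i j N≤i N≤j → close ε i j (small i N≤i) (small j N≤j)
  where
  close : ∀ ε i j → ℤ.+ 1 ℚ./ suc i ℚ.< ε → ℤ.+ 1 ℚ./ suc j ℚ.< ε →
          ℚ.∣ √-seq n i ℚ.- √-seq n j ∣ ℚ.< ε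
  close ε i j p q with ℚ.∣p∣≡p∨∣p∣≡-p (√-seq n i ℚ.- √-seq n j)
  ... | inj₁ eq = ≡.subst (ℚ._< ε) (≡.sym eq) (ℚ.≤-<-trans (√-diff n i j) q)
  ... | inj₂ eq = ≡.subst (ℚ._< ε) (≡.sym (≡.trans eq (flip (√-seq n i) (√-seq n j))))
                    (ℚ.≤-<-trans (√-diff n j i) p)
    where
    open ℚ.+-*-Solver
    flip : ∀ x y → ℚ.- (x ℚ.- y) ≡ y ℚ.- x
    flip = solve 2 (λ x y → :- (x :- y) := y :- x) refl

------------------------------------------------------------------------
-- Finite groups, not assumed commutative, in additive notation

record FiniteGroup c ℓ : Set (lsuc (c ⊔ ℓ)) where
  field
    group : Group c ℓ

  open Group group public
    using (Carrier; _≈_; setoid)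
    renaming (_∙_ to _+_; ε to 0#; _⁻¹ to -_; _//_ to _-_)

  field
    order       : ℕ
    enumeration : Inverse setoid (≡.setoid (Fin order))

  open Inverse enumeration using (to; from)

  instance
    order-nonZero : NonZero order
    order-nonZero = Fin.nonZeroIndex (to 0#)

  infix 4 _≟_
  _≟_ : Decidable _≈_
  _≟_ = via-injection (Inverse⇒Injection enumeration) Fin._≟_

  -- For P respecting ≈, the number of elements (≈-classes) satisfying P.
  # : ∀ {p} {P : U.Pred Carrier p} → U.Decidable P → ℕ
  # P? = count P? (tabulate from)

module _ {c₁ ℓ₁ c₂ ℓ₂} (G : FiniteGroup c₁ ℓ₁) (H : FiniteGroup c₂ ℓ₂) where
  private
    module G = FiniteGroup G
    module H = FiniteGroup H

  Map : Set (c₁ ⊔ ℓ₁ ⊔ c₂ ⊔ ℓ₂)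
  Map = Func G.setoid H.setoid

  module _ (F : Map) where
    open Func F renaming (to to f)

    -- Compared in ℚ, since |H| is not assumed to divide |G|.
    PerfectNonlinear : Set (c₁ ⊔ ℓ₁ ⊔ c₂)
    PerfectNonlinear = ∀ a → ¬ a G.≈ G.0# → ∀ b →
      ℤ.+ G.# (λ x → (f (x G.+ a) H.- f x) H.≟ b) ℚ./ 1 ≡ ℤ.+ G.order ℚ./ H.order

    preimageSize : H.Carrier → ℕ
    preimageSize β = G.# (λ x → f x H.≟ β)

{-# OPTIONS --safe #-}
-- Put n = |G|, h = |H|, k_β = |F⁻¹(β)| and d_β = h k_β − n.  Then ∑ d_β = 0, and
-- counting the pairs (x, y) with F x = F y by their difference gives
-- ∑ d_β² = h n (h − 1).  For fixed α these two sums yield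
--   ∑_{β ≠ α} ((h − 1) d_β + d_α)² = h (h − 1) (n (h − 1)² − d_α²),
-- so d_α² ≤ n (h − 1)², with equality only if (h − 1) d_β = − d_α for every
-- β ≠ α; in that case n = d_β² and √n = |d_β|.
module Submission where

open import Defs
open import Data.Nat.Base using (ℕ; _*_; _<_)
open import Data.Product.Base using (_×_; ∃)
open import Data.Sum.Base using (_⊎_)
open import Relation.Binary.PropositionalEquality using (_≡_)
open import Relation.Nullary using (¬_)

open import Algebra.Bundles using (Group)
import Algebra.Properties.Group as GroupProperties
open import Data.Bool.Base using (if_then_else_; true; false)
open import Data.Fin.Base using (Fin; zero; suc; punchIn; punchOut)
open import Data.Fin.Permutation using (Permutation; permutation)
import Data.Fin.Properties as Fin
open import Data.Integer.Base as ℤ using (ℤ)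
import Data.Integer.Properties as ℤ
import Data.Integer.Tactic.RingSolver as ℤR
open import Data.Nat.Base as ℕ using (zero; suc; pred; NonZero)
import Data.Nat.Properties as ℕ
import Data.Nat.Tactic.RingSolver as ℕR
open import Data.Product.Base using (_,_; proj₁; proj₂)
open import Data.Rational.Base as ℚ using (ℚ; 0ℚ; 1ℚ; ½; toℚᵘ)
import Data.Rational.Properties as ℚ
import Data.Rational.Solver as ℚ
import Data.Rational.Unnormalised.Base as ℚᵘ
import Data.Rational.Unnormalised.Properties as ℚᵘ
open import Data.Sum.Base using (inj₁; inj₂)
open import Data.Vec.Base using (count; tabulate)
open import Function.Base using (_∘_)
open import Function.Bundles using (Func; Inverse)
open import Relation.Binary.PropositionalEquality
  using (_≗_; _≢_; refl; sym; trans; cong; cong₂; subst; subst₂; module ≡-Reasoning)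
open import Relation.Nullary using (Dec; yes; no; does; contradiction)
import Relation.Unary as U

open import Algebra.Properties.Semiring.Sum ℕ.+-*-semiring
  using (sum; sum-cong-≗; sum-remove; ∑-comm; ∑-permute; ∑-distrib-+; *-distribˡ-sum; *-distribʳ-sum)
open import Algebra.Properties.Semiring.Sum ℤ.+-*-semiring
  using () renaming (sum to sumℤ; sum-cong-≗ to sumℤ-cong; sum-remove to sumℤ-remove)
open ℚ.+-*-Solver using (solve; con; _:+_; _:*_; _:-_; :-_; _:=_)

-- Counting pairs with equal images

indicator : ∀ {p} {P : Set p} → Dec P → ℕ
indicator P? = if does P? then 1 else 0

indicator-cong : ∀ {p q} {P : Set p} {Q : Set q} (P? : Dec P) (Q? : Dec Q) →
                 (P → Q) → (Q → P) → indicator P? ≡ indicator Q?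
indicator-cong (yes _) (yes _) _ _ = refl
indicator-cong (yes p) (no ¬q) f _ = contradiction (f p) ¬q
indicator-cong (no ¬p) (yes q) _ g = contradiction (g q) ¬p
indicator-cong (no _)  (no _)  _ _ = refl

indicator-true : ∀ {p} {P : Set p} (P? : Dec P) → P → indicator P? ≡ 1
indicator-true (yes _) _ = refl
indicator-true (no ¬p) p = contradiction p ¬p

count-tabulate : ∀ {a p} {A : Set a} {P : U.Pred A p} (P? : U.Decidable P) {n} (f : Fin n → A) →
                 count P? (tabulate f) ≡ sum (λ i → indicator (P? (f i)))
count-tabulate P? {zero}  f = refl
count-tabulate P? {suc n} f with does (P? (f zero))
... | true  = cong suc (count-tabulate P? (f ∘ suc))
... | false = count-tabulate P? (f ∘ suc)

sum-const : ∀ n c → sum {n} (λ _ → c) ≡ n * c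
sum-const zero    c = refl
sum-const (suc n) c = cong (c ℕ.+_) (sum-const n c)

sum-indicator : ∀ {p n} {P : U.Pred (Fin n) p} (P? : U.Decidable P) (w : Fin n → ℕ) i →
                P i → (∀ j → P j → j ≡ i) → sum (λ j → indicator (P? j) * w j) ≡ w i
sum-indicator {n = suc n} P? w i Pi unique = begin
  sum t                                      ≡⟨ sum-remove {i = i} t ⟩
  t i ℕ.+ sum (λ j → t (punchIn i j))        ≡⟨ cong₂ ℕ._+_ t-i (trans (sum-cong-≗ t-j) (trans (sum-const n 0) (ℕ.*-zeroʳ n))) ⟩
  w i ℕ.+ 0                                  ≡⟨ ℕ.+-identityʳ (w i) ⟩
  w i                                        ∎
  where
  open ≡-Reasoning
  t : Fin (suc n) → ℕ
  t j = indicator (P? j) * w j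
  t-i : t i ≡ w i
  t-i = trans (cong (_* w i) (indicator-true (P? i) Pi)) (ℕ.*-identityˡ (w i))
  t-j : ∀ j → t (punchIn i j) ≡ 0
  t-j j with P? (punchIn i j)
  ... | yes Pj = contradiction (unique (punchIn i j) Pj) (Fin.punchInᵢ≢i i j)
  ... | no _   = refl

module _ {c ℓ} (G : FiniteGroup c ℓ) where
  open FiniteGroup G
  open Group group using () renaming
    (sym to ≈-sym; trans to ≈-trans; ∙-congˡ to +-congˡ;
     assoc to +-assoc; inverseˡ to -‿inverseˡ; inverseʳ to -‿inverseʳ;
     identityˡ to +-identityˡ; ∙-congʳ to +-congʳ)
  open Inverse enumeration using (to; from; to-cong; strictlyInverseˡ; strictlyInverseʳ)

  #-sum : ∀ {p} {P : U.Pred Carrier p} (P? : U.Decidable P) →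
          # P? ≡ sum (λ i → indicator (P? (from i)))
  #-sum P? = count-tabulate P? from

  translation : Carrier → Permutation order order
  translation x = permutation (λ i → to (x + from i)) (λ i → to ((- x) + from i))
    (λ i → trans
      (to-cong (≈-trans (+-congˡ (strictlyInverseʳ _))
        (≈-trans (≈-sym (+-assoc x (- x) (from i)))
          (≈-trans (+-congʳ (-‿inverseʳ x)) (+-identityˡ (from i))))))
      (strictlyInverseˡ i))
    (λ i → trans
      (to-cong (≈-trans (+-congˡ (strictlyInverseʳ _))
        (≈-trans (≈-sym (+-assoc (- x) x (from i)))
          (≈-trans (+-congʳ (-‿inverseˡ x)) (+-identityˡ (from i))))))
      (strictlyInverseˡ i))

  sum-enumeration : ∀ x (w : Fin order → ℕ) → sum (λ j → indicator (x ≟ from j) * w j) ≡ w (to x)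
  sum-enumeration x w = sum-indicator (λ j → x ≟ from j) w (to x) (≈-sym (strictlyInverseʳ x))
    λ j x≈j → trans (sym (strictlyInverseˡ j)) (to-cong (≈-sym x≈j))

  sum-enumeration-1 : ∀ x → sum (λ j → indicator (x ≟ from j)) ≡ 1
  sum-enumeration-1 x = trans
    (sum-cong-≗ λ j → sym (ℕ.*-identityʳ (indicator (x ≟ from j)))) (sum-enumeration x (λ _ → 1))

module _ {c₁ ℓ₁ c₂ ℓ₂} (G : FiniteGroup c₁ ℓ₁) (H : FiniteGroup c₂ ℓ₂) (F : Map G H) where
  private
    module G where
      open FiniteGroup G public
      open Group group public using () renaming (sym to ≈-sym; trans to ≈-trans; ∙-congˡ to +-congˡ; identityʳ to +-identityʳ)
      open Inverse enumeration public using (to; from; strictlyInverseʳ)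
    module H where
      open FiniteGroup H public
      open Group group public using () renaming (sym to ≈-sym; trans to ≈-trans)
      open GroupProperties group public using (x∙y⁻¹≈ε⇒x≈y; x≈y⇒x∙y⁻¹≈ε)
      open Inverse enumeration public using (to; from; strictlyInverseʳ)
    open Func F renaming (to to f; cong to f-cong)

  preimageSize-cong : ∀ {β γ} → β H.≈ γ → preimageSize G H F β ≡ preimageSize G H F γ
  preimageSize-cong {β} {γ} β≈γ = begin
    preimageSize G H F β                             ≡⟨ #-sum G _ ⟩
    sum (λ i → indicator (f (G.from i) H.≟ β))       ≡⟨ sum-cong-≗ (λ i → indicator-cong (f (G.from i) H.≟ β) (f (G.from i) H.≟ γ)
                                                          (λ p → H.≈-trans p β≈γ) (λ p → H.≈-trans p (H.≈-sym β≈γ))) ⟩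
    sum (λ i → indicator (f (G.from i) H.≟ γ))       ≡⟨ #-sum G _ ⟨
    preimageSize G H F γ                             ∎
    where open ≡-Reasoning

  fibre : Fin H.order → ℕ
  fibre j = preimageSize G H F (H.from j)

  sum-fibre : sum fibre ≡ G.order
  sum-fibre = begin
    sum fibre                                                             ≡⟨ sum-cong-≗ (λ j → #-sum G (λ x → f x H.≟ H.from j)) ⟩
    sum (λ j → sum (λ i → indicator (f (G.from i) H.≟ H.from j)))         ≡⟨ ∑-comm (λ j i → indicator (f (G.from i) H.≟ H.from j)) ⟩
    sum (λ i → sum (λ j → indicator (f (G.from i) H.≟ H.from j)))         ≡⟨ sum-cong-≗ (λ i → sum-enumeration-1 H (f (G.from i))) ⟩
    sum {G.order} (λ _ → 1)                                               ≡⟨ sum-const G.order 1 ⟩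
    G.order * 1                                                           ≡⟨ ℕ.*-identityʳ G.order ⟩
    G.order                                                               ∎
    where open ≡-Reasoning

  collisions : G.Carrier → ℕ
  collisions a = G.# (λ x → (f (x G.+ a) H.- f x) H.≟ H.0#)

  -- Both sides count the pairs (x, y) with f x ≈ f y, on the right via y = x + a.
  sum-fibre² : sum (λ j → fibre j * fibre j) ≡ sum (λ i → collisions (G.from i))
  sum-fibre² = begin
    sum (λ j → fibre j * fibre j)
      ≡⟨ sum-cong-≗ (λ j → trans (cong (_* fibre j) (#-sum G (λ x → f x H.≟ H.from j))) (*-distribʳ-sum (fibre j) (λ i → indicator (f (G.from i) H.≟ H.from j)))) ⟩
    sum (λ j → sum (λ i → indicator (f (G.from i) H.≟ H.from j) * fibre j))
      ≡⟨ ∑-comm (λ j i → indicator (f (G.from i) H.≟ H.from j) * fibre j) ⟩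
    sum (λ i → sum (λ j → indicator (f (G.from i) H.≟ H.from j) * fibre j))
      ≡⟨ sum-cong-≗ (λ i → trans (sum-enumeration H (f (G.from i)) fibre)
           (trans (preimageSize-cong (H.strictlyInverseʳ (f (G.from i)))) (#-sum G _))) ⟩
    sum (λ i → sum (λ j → indicator (f (G.from j) H.≟ f (G.from i))))
      ≡⟨ sum-cong-≗ (λ i → trans (∑-permute _ (translation G (G.from i)))
           (sum-cong-≗ (λ a → translate (G.from i) (G.from a)))) ⟩
    sum (λ i → sum (λ a → indicator ((f (G.from i G.+ G.from a) H.- f (G.from i)) H.≟ H.0#)))
      ≡⟨ ∑-comm (λ i a → indicator ((f (G.from i G.+ G.from a) H.- f (G.from i)) H.≟ H.0#)) ⟩
    sum (λ a → sum (λ i → indicator ((f (G.from i G.+ G.from a) H.- f (G.from i)) H.≟ H.0#)))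
      ≡⟨ sum-cong-≗ (λ a → #-sum G (λ x → (f (x G.+ G.from a) H.- f x) H.≟ H.0#)) ⟨
    sum (λ a → collisions (G.from a)) ∎
    where
    open ≡-Reasoning
    translate : ∀ x a → indicator (f (G.from (G.to (x G.+ a))) H.≟ f x) ≡ indicator ((f (x G.+ a) H.- f x) H.≟ H.0#)
    translate x a = indicator-cong (f (G.from (G.to (x G.+ a))) H.≟ f x) ((f (x G.+ a) H.- f x) H.≟ H.0#)
      (λ p → H.x≈y⇒x∙y⁻¹≈ε {f (x G.+ a)} {f x} (H.≈-trans (f-cong (G.≈-sym (G.strictlyInverseʳ _))) p))
      (λ p → H.≈-trans (f-cong (G.strictlyInverseʳ _)) (H.x∙y⁻¹≈ε⇒x≈y _ _ p))

  collisions-0 : ∀ {a} → a G.≈ G.0# → collisions a ≡ G.order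
  collisions-0 {a} a≈0 = begin
    collisions a
      ≡⟨ #-sum G _ ⟩
    sum (λ i → indicator ((f (G.from i G.+ a) H.- f (G.from i)) H.≟ H.0#))
      ≡⟨ sum-cong-≗ (λ i → indicator-true ((f (G.from i G.+ a) H.- f (G.from i)) H.≟ H.0#)
           (H.x≈y⇒x∙y⁻¹≈ε {f (G.from i G.+ a)} {f (G.from i)} (f-cong (G.≈-trans (G.+-congˡ a≈0) (G.+-identityʳ (G.from i)))))) ⟩
    sum {G.order} (λ _ → 1)
      ≡⟨ sum-const G.order 1 ⟩
    G.order * 1
      ≡⟨ ℕ.*-identityʳ G.order ⟩
    G.order ∎
    where open ≡-Reasoning

  module _ (uniform : ∀ a → ¬ a G.≈ G.0# → H.order * collisions a ≡ G.order) where

    -- The statement ∑ₐ |H| N(a) = |G||H| + (|G| − 1)|G|, without subtraction.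
    sum-fibre²-uniform : H.order * sum (λ j → fibre j * fibre j) ℕ.+ G.order
                       ≡ G.order * G.order ℕ.+ G.order * H.order
    sum-fibre²-uniform = begin
      h * sum (λ j → fibre j * fibre j) ℕ.+ n
        ≡⟨ cong₂ ℕ._+_ (trans (cong (h *_) sum-fibre²) (*-distribˡ-sum h (λ i → collisions (G.from i)))) (sym (at-zero n)) ⟩
      sum (λ i → h * collisions (G.from i)) ℕ.+ sum (λ i → δ i * n)
        ≡⟨ ∑-distrib-+ (λ i → h * collisions (G.from i)) (λ i → δ i * n) ⟨
      sum (λ i → h * collisions (G.from i) ℕ.+ δ i * n)
        ≡⟨ sum-cong-≗ termwise ⟩
      sum (λ i → n ℕ.+ δ i * (n * h))
        ≡⟨ ∑-distrib-+ (λ _ → n) (λ i → δ i * (n * h)) ⟩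
      sum {n} (λ _ → n) ℕ.+ sum (λ i → δ i * (n * h))
        ≡⟨ cong₂ ℕ._+_ (sum-const n n) (at-zero (n * h)) ⟩
      n * n ℕ.+ n * h ∎
      where
      open ≡-Reasoning
      h n : ℕ
      h = H.order
      n = G.order
      δ : Fin n → ℕ
      δ i = indicator (G.0# G.≟ G.from i)
      at-zero : ∀ c → sum (λ i → δ i * c) ≡ c
      at-zero c = sum-enumeration G G.0# (λ _ → c)
      rearrange : ∀ h n → h * n ℕ.+ 1 * n ≡ n ℕ.+ 1 * (n * h)
      rearrange = ℕR.solve-∀
      split : ∀ {p} {P : Set p} (P? : Dec P) {c} → (P → c ≡ n) → (¬ P → h * c ≡ n) →
              h * c ℕ.+ indicator P? * n ≡ n ℕ.+ indicator P? * (n * h)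
      split (yes p) c≡n _ = trans (cong (λ c → h * c ℕ.+ 1 * n) (c≡n p)) (rearrange h n)
      split (no ¬p) _ hc≡n = cong (ℕ._+ 0) (hc≡n ¬p)
      termwise : ∀ i → h * collisions (G.from i) ℕ.+ δ i * n ≡ n ℕ.+ δ i * (n * h)
      termwise i = split (G.0# G.≟ G.from i)
        (λ 0≈i → collisions-0 (G.≈-sym 0≈i)) (λ 0≉i → uniform (G.from i) (0≉i ∘ G.≈-sym))

-- Sums of deviations from the mean

sum-affine : ∀ {m} a b (f : Fin m → ℤ) → sumℤ (λ j → a ℤ.* f j ℤ.+ b) ≡ a ℤ.* sumℤ f ℤ.+ ℤ.+ m ℤ.* b
sum-affine {zero}  a b f = base a b
  where
  base : ∀ a b → ℤ.0ℤ ≡ a ℤ.* ℤ.0ℤ ℤ.+ ℤ.0ℤ ℤ.* b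
  base = ℤR.solve-∀
sum-affine {suc m} a b f = trans (cong (λ s → a ℤ.* f zero ℤ.+ b ℤ.+ s) (sum-affine a b (f ∘ suc)))
  (step a b (f zero) (sumℤ (f ∘ suc)) (ℤ.+ m))
  where
  step : ∀ a b x s m → a ℤ.* x ℤ.+ b ℤ.+ (a ℤ.* s ℤ.+ m ℤ.* b) ≡ a ℤ.* (x ℤ.+ s) ℤ.+ (ℤ.1ℤ ℤ.+ m) ℤ.* b
  step = ℤR.solve-∀

sum-affine² : ∀ {m} a b (f : Fin m → ℤ) →
  sumℤ (λ j → (a ℤ.* f j ℤ.+ b) ℤ.* (a ℤ.* f j ℤ.+ b)) ≡
  a ℤ.* a ℤ.* sumℤ (λ j → f j ℤ.* f j) ℤ.+ (a ℤ.+ a) ℤ.* b ℤ.* sumℤ f ℤ.+ ℤ.+ m ℤ.* (b ℤ.* b)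
sum-affine² {zero}  a b f = base a b
  where
  base : ∀ a b → ℤ.0ℤ ≡ a ℤ.* a ℤ.* ℤ.0ℤ ℤ.+ (a ℤ.+ a) ℤ.* b ℤ.* ℤ.0ℤ ℤ.+ ℤ.0ℤ ℤ.* (b ℤ.* b)
  base = ℤR.solve-∀
sum-affine² {suc m} a b f = trans (cong (λ s → (a ℤ.* f zero ℤ.+ b) ℤ.* (a ℤ.* f zero ℤ.+ b) ℤ.+ s) (sum-affine² a b (f ∘ suc)))
  (step a b (f zero) (sumℤ (λ j → f (suc j) ℤ.* f (suc j))) (sumℤ (f ∘ suc)) (ℤ.+ m))
  where
  step : ∀ a b x t s m →
    (a ℤ.* x ℤ.+ b) ℤ.* (a ℤ.* x ℤ.+ b) ℤ.+ (a ℤ.* a ℤ.* t ℤ.+ (a ℤ.+ a) ℤ.* b ℤ.* s ℤ.+ m ℤ.* (b ℤ.* b)) ≡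
    a ℤ.* a ℤ.* (x ℤ.* x ℤ.+ t) ℤ.+ (a ℤ.+ a) ℤ.* b ℤ.* (x ℤ.+ s) ℤ.+ (ℤ.1ℤ ℤ.+ m) ℤ.* (b ℤ.* b)
  step = ℤR.solve-∀


i*i≡+∣i∣² : ∀ i → i ℤ.* i ≡ ℤ.+ (ℤ.∣ i ∣ * ℤ.∣ i ∣)
i*i≡+∣i∣² (ℤ.+ n)    = sym (ℤ.pos-* n n)
i*i≡+∣i∣² ℤ.-[1+ n ] = refl

0≤i*i : ∀ i → ℤ.0ℤ ℤ.≤ i ℤ.* i
0≤i*i i = subst (ℤ.0ℤ ℤ.≤_) (sym (i*i≡+∣i∣² i)) (ℤ.+≤+ ℕ.z≤n)

i*i≡0⇒i≡0 : ∀ i → i ℤ.* i ≡ ℤ.0ℤ → i ≡ ℤ.0ℤ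
i*i≡0⇒i≡0 i i*i≡0 with ℤ.i*j≡0⇒i≡0∨j≡0 i i*i≡0
... | inj₁ i≡0 = i≡0
... | inj₂ i≡0 = i≡0

+-squeeze-0 : ∀ {i j} → ℤ.0ℤ ℤ.≤ i → ℤ.0ℤ ℤ.≤ j → i ℤ.+ j ≡ ℤ.0ℤ → i ≡ ℤ.0ℤ × j ≡ ℤ.0ℤ
+-squeeze-0 {ℤ.+ zero} {ℤ.+ zero} _ _ _ = refl , refl

0≤sum-squares : ∀ {m} (f : Fin m → ℤ) → ℤ.0ℤ ℤ.≤ sumℤ (λ j → f j ℤ.* f j)
0≤sum-squares {zero}  f = ℤ.≤-refl
0≤sum-squares {suc m} f = ℤ.+-mono-≤ (0≤i*i (f zero)) (0≤sum-squares (f ∘ suc))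

sum-squares≡0 : ∀ {m} (f : Fin m → ℤ) → sumℤ (λ j → f j ℤ.* f j) ≡ ℤ.0ℤ → ∀ j → f j ≡ ℤ.0ℤ
sum-squares≡0 {suc m} f eq j with +-squeeze-0 (0≤i*i (f zero)) (0≤sum-squares (f ∘ suc)) eq
sum-squares≡0 {suc m} f eq zero    | p , _ = i*i≡0⇒i≡0 (f zero) p
sum-squares≡0 {suc m} f eq (suc j) | _ , q = sum-squares≡0 (f ∘ suc) q j

sum-+ : ∀ {m} (f : Fin m → ℕ) → sumℤ (λ j → ℤ.+ f j) ≡ ℤ.+ sum f
sum-+ {zero}  f = refl
sum-+ {suc m} f = trans (cong (λ s → ℤ.+ f zero ℤ.+ s) (sum-+ (f ∘ suc))) (sym (ℤ.pos-+ (f zero) (sum (f ∘ suc))))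

module _ {q} (d : Fin (suc q) → ℤ) (n : ℕ) (sum-d : sumℤ d ≡ ℤ.0ℤ)
         (sum-d² : sumℤ (λ j → d j ℤ.* d j) ≡ ℤ.+ suc q ℤ.* ℤ.+ n ℤ.* ℤ.+ q) (i : Fin (suc q)) where
  private
    g : Fin q → ℤ
    g j = ℤ.+ q ℤ.* d (punchIn i j) ℤ.+ d i

    spread : sumℤ (λ j → g j ℤ.* g j) ≡ ℤ.+ q ℤ.* (ℤ.+ suc q ℤ.* (ℤ.+ n ℤ.* (ℤ.+ q ℤ.* ℤ.+ q) ℤ.- d i ℤ.* d i))
    spread = begin
      sumℤ (λ j → g j ℤ.* g j)
        ≡⟨ sum-affine² (ℤ.+ q) (d i) (d ∘ punchIn i) ⟩
      Q ℤ.* Q ℤ.* t ℤ.+ (Q ℤ.+ Q) ℤ.* x ℤ.* s ℤ.+ Q ℤ.* (x ℤ.* x)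
        ≡⟨ expand Q x s t ⟩
      Q ℤ.* Q ℤ.* (x ℤ.* x ℤ.+ t) ℤ.+ (Q ℤ.+ Q) ℤ.* x ℤ.* (x ℤ.+ s) ℤ.- Q ℤ.* (ℤ.1ℤ ℤ.+ Q) ℤ.* (x ℤ.* x)
        ≡⟨ cong₂ (λ u v → Q ℤ.* Q ℤ.* u ℤ.+ (Q ℤ.+ Q) ℤ.* x ℤ.* v ℤ.- Q ℤ.* (ℤ.1ℤ ℤ.+ Q) ℤ.* (x ℤ.* x))
             (trans (sym (sumℤ-remove {i = i} (λ j → d j ℤ.* d j))) sum-d²)
             (trans (sym (sumℤ-remove {i = i} d)) sum-d) ⟩
      Q ℤ.* Q ℤ.* ((ℤ.1ℤ ℤ.+ Q) ℤ.* ℤ.+ n ℤ.* Q) ℤ.+ (Q ℤ.+ Q) ℤ.* x ℤ.* ℤ.0ℤ ℤ.- Q ℤ.* (ℤ.1ℤ ℤ.+ Q) ℤ.* (x ℤ.* x)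
        ≡⟨ collect Q x (ℤ.+ n) ⟩
      Q ℤ.* ((ℤ.1ℤ ℤ.+ Q) ℤ.* (ℤ.+ n ℤ.* (Q ℤ.* Q) ℤ.- x ℤ.* x)) ∎
      where
      open ≡-Reasoning
      Q x s t : ℤ
      Q = ℤ.+ q
      x = d i
      s = sumℤ (d ∘ punchIn i)
      t = sumℤ (λ j → d (punchIn i j) ℤ.* d (punchIn i j))
      expand : ∀ Q x s t → Q ℤ.* Q ℤ.* t ℤ.+ (Q ℤ.+ Q) ℤ.* x ℤ.* s ℤ.+ Q ℤ.* (x ℤ.* x) ≡
        Q ℤ.* Q ℤ.* (x ℤ.* x ℤ.+ t) ℤ.+ (Q ℤ.+ Q) ℤ.* x ℤ.* (x ℤ.+ s) ℤ.- Q ℤ.* (ℤ.1ℤ ℤ.+ Q) ℤ.* (x ℤ.* x)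
      expand = ℤR.solve-∀
      collect : ∀ Q x n → Q ℤ.* Q ℤ.* ((ℤ.1ℤ ℤ.+ Q) ℤ.* n ℤ.* Q) ℤ.+ (Q ℤ.+ Q) ℤ.* x ℤ.* ℤ.0ℤ ℤ.- Q ℤ.* (ℤ.1ℤ ℤ.+ Q) ℤ.* (x ℤ.* x) ≡
        Q ℤ.* ((ℤ.1ℤ ℤ.+ Q) ℤ.* (n ℤ.* (Q ℤ.* Q) ℤ.- x ℤ.* x))
      collect = ℤR.solve-∀

  bound : .{{NonZero q}} → d i ℤ.* d i ℤ.≤ ℤ.+ n ℤ.* (ℤ.+ q ℤ.* ℤ.+ q)
  bound = ℤ.0≤i-j⇒j≤i (ℤ.*-cancelˡ-≤-pos ℤ.0ℤ e (ℤ.+ suc q) (subst (ℤ._≤ ℤ.+ suc q ℤ.* e) (sym (ℤ.*-zeroʳ (ℤ.+ suc q)))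
    (ℤ.*-cancelˡ-≤-pos ℤ.0ℤ (ℤ.+ suc q ℤ.* e) (ℤ.+ q) {{ℤ.positive (ℤ.+<+ (ℕ.>-nonZero⁻¹ q))}}
      (subst₂ ℤ._≤_ (sym (ℤ.*-zeroʳ (ℤ.+ q))) spread (0≤sum-squares g)))))
      where
      e : ℤ
      e = ℤ.+ n ℤ.* (ℤ.+ q ℤ.* ℤ.+ q) ℤ.- d i ℤ.* d i

  extremal : d i ℤ.* d i ≡ ℤ.+ n ℤ.* (ℤ.+ q ℤ.* ℤ.+ q) → ∀ {j} → i ≢ j → ℤ.+ q ℤ.* d j ℤ.+ d i ≡ ℤ.0ℤ
  extremal eq i≢j = subst (λ j → ℤ.+ q ℤ.* d j ℤ.+ d i ≡ ℤ.0ℤ) (Fin.punchIn-punchOut i≢j)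
    (sum-squares≡0 g
      (trans spread (trans (cong (λ y → ℤ.+ q ℤ.* (ℤ.+ suc q ℤ.* y)) (trans (cong (λ y → ℤ.+ n ℤ.* (ℤ.+ q ℤ.* ℤ.+ q) ℤ.- y) eq) (ℤ.+-inverseʳ (ℤ.+ n ℤ.* (ℤ.+ q ℤ.* ℤ.+ q)))))
        (trans (cong (λ y → ℤ.+ q ℤ.* y) (ℤ.*-zeroʳ (ℤ.+ suc q))) (ℤ.*-zeroʳ (ℤ.+ q)))))
      (punchOut i≢j))

deviation-bound : ∀ {h} (d : Fin h → ℤ) n → sumℤ d ≡ ℤ.0ℤ →
                  sumℤ (λ j → d j ℤ.* d j) ≡ ℤ.+ h ℤ.* ℤ.+ n ℤ.* ℤ.+ pred h →
                  ∀ i → d i ℤ.* d i ℤ.≤ ℤ.+ n ℤ.* (ℤ.+ pred h ℤ.* ℤ.+ pred h)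
deviation-bound {suc zero}    d n sum-d sum-d² zero = ℤ.≤-reflexive (trans (sym (ℤ.+-identityʳ (d zero ℤ.* d zero)))
  (trans sum-d² (trans (ℤ.*-zeroʳ (ℤ.1ℤ ℤ.* ℤ.+ n)) (sym (ℤ.*-zeroʳ (ℤ.+ n))))))
deviation-bound {suc (suc q)} d n sum-d sum-d² i    = bound d n sum-d sum-d² i

deviation-extremal : ∀ {h} (d : Fin h → ℤ) n → sumℤ d ≡ ℤ.0ℤ →
                     sumℤ (λ j → d j ℤ.* d j) ≡ ℤ.+ h ℤ.* ℤ.+ n ℤ.* ℤ.+ pred h →
                     ∀ i → d i ℤ.* d i ≡ ℤ.+ n ℤ.* (ℤ.+ pred h ℤ.* ℤ.+ pred h) →
                     ∀ {j} → i ≢ j → ℤ.+ pred h ℤ.* d j ℤ.+ d i ≡ ℤ.0ℤ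
deviation-extremal {suc q} = extremal

deviation : ℕ → ℕ → ℕ → ℤ
deviation n h k = ℤ.+ h ℤ.* ℤ.+ k ℤ.- ℤ.+ n

sum-deviation : ∀ {n h} (k : Fin h → ℕ) → sum k ≡ n → sumℤ (λ j → deviation n h (k j)) ≡ ℤ.0ℤ
sum-deviation {n} {h} k sum-k = begin
  sumℤ (λ j → deviation n h (k j))                          ≡⟨ sum-affine (ℤ.+ h) (ℤ.- ℤ.+ n) (λ j → ℤ.+ k j) ⟩
  ℤ.+ h ℤ.* sumℤ (λ j → ℤ.+ k j) ℤ.+ ℤ.+ h ℤ.* ℤ.- ℤ.+ n    ≡⟨ cong (λ s → ℤ.+ h ℤ.* s ℤ.+ ℤ.+ h ℤ.* ℤ.- ℤ.+ n) (trans (sum-+ k) (cong ℤ.+_ sum-k)) ⟩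
  ℤ.+ h ℤ.* ℤ.+ n ℤ.+ ℤ.+ h ℤ.* ℤ.- ℤ.+ n                   ≡⟨ cancel (ℤ.+ h) (ℤ.+ n) ⟩
  ℤ.0ℤ                                                      ∎
  where
  open ≡-Reasoning
  cancel : ∀ h n → h ℤ.* n ℤ.+ h ℤ.* ℤ.- n ≡ ℤ.0ℤ
  cancel = ℤR.solve-∀

sum-deviation² : ∀ {n h} .{{_ : NonZero h}} (k : Fin h → ℕ) → sum k ≡ n →
  h * sum (λ j → k j * k j) ℕ.+ n ≡ n * n ℕ.+ n * h →
  sumℤ (λ j → deviation n h (k j) ℤ.* deviation n h (k j)) ≡ ℤ.+ h ℤ.* ℤ.+ n ℤ.* ℤ.+ pred h
sum-deviation² {n} {h@(suc q)} k sum-k sum-k² = begin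
  sumℤ (λ j → deviation n h (k j) ℤ.* deviation n h (k j))
    ≡⟨ sum-affine² (ℤ.+ h) (ℤ.- ℤ.+ n) (λ j → ℤ.+ k j) ⟩
  ℤ.+ h ℤ.* ℤ.+ h ℤ.* sumℤ (λ j → ℤ.+ k j ℤ.* ℤ.+ k j) ℤ.+ (ℤ.+ h ℤ.+ ℤ.+ h) ℤ.* ℤ.- ℤ.+ n ℤ.* sumℤ (λ j → ℤ.+ k j) ℤ.+ ℤ.+ h ℤ.* (ℤ.- ℤ.+ n ℤ.* ℤ.- ℤ.+ n)
    ≡⟨ cong₂ (λ t s → ℤ.+ h ℤ.* ℤ.+ h ℤ.* t ℤ.+ (ℤ.+ h ℤ.+ ℤ.+ h) ℤ.* ℤ.- ℤ.+ n ℤ.* s ℤ.+ ℤ.+ h ℤ.* (ℤ.- ℤ.+ n ℤ.* ℤ.- ℤ.+ n))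
         (trans (sumℤ-cong (λ j → sym (ℤ.pos-* (k j) (k j)))) (sum-+ (λ j → k j * k j)))
         (trans (sum-+ k) (cong ℤ.+_ sum-k)) ⟩
  ℤ.+ h ℤ.* ℤ.+ h ℤ.* ℤ.+ t ℤ.+ (ℤ.+ h ℤ.+ ℤ.+ h) ℤ.* ℤ.- ℤ.+ n ℤ.* ℤ.+ n ℤ.+ ℤ.+ h ℤ.* (ℤ.- ℤ.+ n ℤ.* ℤ.- ℤ.+ n)
    ≡⟨ collect (ℤ.+ h) (ℤ.+ n) (ℤ.+ t) ⟩
  ℤ.+ h ℤ.* (ℤ.+ h ℤ.* ℤ.+ t ℤ.+ ℤ.+ n ℤ.- ℤ.+ n ℤ.* ℤ.+ n ℤ.- ℤ.+ n)
    ≡⟨ cong (λ y → ℤ.+ h ℤ.* (y ℤ.- ℤ.+ n ℤ.* ℤ.+ n ℤ.- ℤ.+ n)) (begin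
         ℤ.+ h ℤ.* ℤ.+ t ℤ.+ ℤ.+ n               ≡⟨ cong (λ y → y ℤ.+ ℤ.+ n) (ℤ.pos-* h t) ⟨
         ℤ.+ (h * t) ℤ.+ ℤ.+ n                   ≡⟨ ℤ.pos-+ (h * t) n ⟨
         ℤ.+ (h * t ℕ.+ n)                       ≡⟨ cong ℤ.+_ sum-k² ⟩
         ℤ.+ (n * n ℕ.+ n * h)                   ≡⟨ ℤ.pos-+ (n * n) (n * h) ⟩
         ℤ.+ (n * n) ℤ.+ ℤ.+ (n * h)             ≡⟨ cong₂ ℤ._+_ (ℤ.pos-* n n) (ℤ.pos-* n h) ⟩
         ℤ.+ n ℤ.* ℤ.+ n ℤ.+ ℤ.+ n ℤ.* ℤ.+ h     ∎) ⟩
  ℤ.+ h ℤ.* (ℤ.+ n ℤ.* ℤ.+ n ℤ.+ ℤ.+ n ℤ.* (ℤ.1ℤ ℤ.+ ℤ.+ q) ℤ.- ℤ.+ n ℤ.* ℤ.+ n ℤ.- ℤ.+ n)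
    ≡⟨ simplify (ℤ.+ h) (ℤ.+ n) (ℤ.+ q) ⟩
  ℤ.+ h ℤ.* ℤ.+ n ℤ.* ℤ.+ q ∎
  where
  open ≡-Reasoning
  t : ℕ
  t = sum (λ j → k j * k j)
  collect : ∀ h n t → h ℤ.* h ℤ.* t ℤ.+ (h ℤ.+ h) ℤ.* ℤ.- n ℤ.* n ℤ.+ h ℤ.* (ℤ.- n ℤ.* ℤ.- n) ≡ h ℤ.* (h ℤ.* t ℤ.+ n ℤ.- n ℤ.* n ℤ.- n)
  collect = ℤR.solve-∀
  simplify : ∀ h n q → h ℤ.* (n ℤ.* n ℤ.+ n ℤ.* (ℤ.1ℤ ℤ.+ q) ℤ.- n ℤ.* n ℤ.- n) ≡ h ℤ.* n ℤ.* q
  simplify = ℤR.solve-∀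

-- Integers and reciprocals in ℚ

ι : ℤ → ℚ
ι z = z ℚ./ 1

recip : (d : ℕ) .{{_ : NonZero d}} → ℚ
recip d = ℤ.+ 1 ℚ./ d

toℚᵘ-ι : ∀ z → toℚᵘ (ι z) ℚᵘ.≃ z ℚᵘ./ 1
toℚᵘ-ι z = ℚ.toℚᵘ-fromℚᵘ (z ℚᵘ./ 1)

ι-+ : ∀ a b → ι (a ℤ.+ b) ≡ ι a ℚ.+ ι b
ι-+ a b = ℚ.toℚᵘ-injective (begin-equality
  toℚᵘ (ι (a ℤ.+ b))               ≃⟨ toℚᵘ-ι (a ℤ.+ b) ⟩
  (a ℤ.+ b) ℚᵘ./ 1                 ≃⟨ ℚᵘ.*≡* (identity a b) ⟩
  a ℚᵘ./ 1 ℚᵘ.+ b ℚᵘ./ 1           ≃⟨ ℚᵘ.+-cong (toℚᵘ-ι a) (toℚᵘ-ι b) ⟨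
  toℚᵘ (ι a) ℚᵘ.+ toℚᵘ (ι b)       ≃⟨ ℚ.toℚᵘ-homo-+ (ι a) (ι b) ⟨
  toℚᵘ (ι a ℚ.+ ι b)               ∎)
  where
  open ℚᵘ.≤-Reasoning
  identity : ∀ a b → (a ℤ.+ b) ℤ.* ℤ.1ℤ ≡ (a ℤ.* ℤ.1ℤ ℤ.+ b ℤ.* ℤ.1ℤ) ℤ.* ℤ.1ℤ
  identity = ℤR.solve-∀

ι-* : ∀ a b → ι (a ℤ.* b) ≡ ι a ℚ.* ι b
ι-* a b = ℚ.toℚᵘ-injective (begin-equality
  toℚᵘ (ι (a ℤ.* b))               ≃⟨ toℚᵘ-ι (a ℤ.* b) ⟩
  (a ℚᵘ./ 1) ℚᵘ.* (b ℚᵘ./ 1)         ≃⟨ ℚᵘ.*-cong (toℚᵘ-ι a) (toℚᵘ-ι b) ⟨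
  toℚᵘ (ι a) ℚᵘ.* toℚᵘ (ι b)       ≃⟨ ℚ.toℚᵘ-homo-* (ι a) (ι b) ⟨
  toℚᵘ (ι a ℚ.* ι b)               ∎)
  where open ℚᵘ.≤-Reasoning

ι-neg : ∀ a → ι (ℤ.- a) ≡ ℚ.- ι a
ι-neg a = ℚ.toℚᵘ-injective (begin-equality
  toℚᵘ (ι (ℤ.- a))                 ≃⟨ toℚᵘ-ι (ℤ.- a) ⟩
  ℚᵘ.- (a ℚᵘ./ 1)                  ≃⟨ ℚᵘ.-‿cong (toℚᵘ-ι a) ⟨
  ℚᵘ.- toℚᵘ (ι a)                  ≃⟨ ℚ.toℚᵘ-homo‿- (ι a) ⟨
  toℚᵘ (ℚ.- ι a)                   ∎)
  where open ℚᵘ.≤-Reasoning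

ι-- : ∀ a b → ι (a ℤ.- b) ≡ ι a ℚ.- ι b
ι-- a b = trans (ι-+ a (ℤ.- b)) (cong (λ y → ι a ℚ.+ y) (ι-neg b))

ι-mono-≤ : ∀ {a b} → a ℤ.≤ b → ι a ℚ.≤ ι b
ι-mono-≤ {a} {b} a≤b = ℚ.toℚᵘ-cancel-≤ (ℚᵘ.≤-respʳ-≃ (ℚᵘ.≃-sym (toℚᵘ-ι b)) (ℚᵘ.≤-respˡ-≃ (ℚᵘ.≃-sym (toℚᵘ-ι a))
  (ℚᵘ.*≤* (ℤ.*-monoʳ-≤-nonNeg ℤ.1ℤ a≤b))))

ι-injective : ∀ {a b} → ι a ≡ ι b → a ≡ b
ι-injective {a} {b} eq with ℚ./-injective-≃ (a ℚᵘ./ 1) (b ℚᵘ./ 1) eq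
... | ℚᵘ.*≡* p = ℤ.*-cancelʳ-≡ a b ℤ.1ℤ p

/≡ι*recip : ∀ z d .{{_ : NonZero d}} → z ℚ./ d ≡ ι z ℚ.* recip d
/≡ι*recip z d@(suc _) = ℚ.toℚᵘ-injective (begin-equality
  toℚᵘ (z ℚ./ d)                       ≃⟨ ℚ.toℚᵘ-fromℚᵘ (z ℚᵘ./ d) ⟩
  z ℚᵘ./ d                             ≃⟨ ℚᵘ.*≡* (identity z (ℤ.+ d)) ⟩
  (z ℚᵘ./ 1) ℚᵘ.* (ℤ.+ 1 ℚᵘ./ d)         ≃⟨ ℚᵘ.*-cong (toℚᵘ-ι z) (ℚ.toℚᵘ-fromℚᵘ (ℤ.+ 1 ℚᵘ./ d)) ⟨
  toℚᵘ (ι z) ℚᵘ.* toℚᵘ (recip d)       ≃⟨ ℚ.toℚᵘ-homo-* (ι z) (recip d) ⟨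
  toℚᵘ (ι z ℚ.* recip d)               ∎)
  where
  open ℚᵘ.≤-Reasoning
  identity : ∀ z d → z ℤ.* (ℤ.1ℤ ℤ.* d) ≡ (z ℤ.* ℤ.1ℤ) ℤ.* d
  identity = ℤR.solve-∀

ι*recip≡1 : ∀ d .{{_ : NonZero d}} → ι (ℤ.+ d) ℚ.* recip d ≡ 1ℚ
ι*recip≡1 d@(suc _) = trans (sym (/≡ι*recip (ℤ.+ d) d)) (ℚ.toℚᵘ-injective (begin-equality
  toℚᵘ (ℤ.+ d ℚ./ d)      ≃⟨ ℚ.toℚᵘ-fromℚᵘ (ℤ.+ d ℚᵘ./ d) ⟩
  ℤ.+ d ℚᵘ./ d            ≃⟨ ℚᵘ.*≡* (ℤ.*-comm (ℤ.+ d) ℤ.1ℤ) ⟩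
  ℚᵘ.1ℚᵘ                  ∎))
  where open ℚᵘ.≤-Reasoning

ι-/ : ∀ {a b} d .{{_ : NonZero d}} → ι a ≡ b ℚ./ d → ℤ.+ d ℤ.* a ≡ b
ι-/ {a} {b} d eq = ι-injective (begin
  ι (ℤ.+ d ℤ.* a)                       ≡⟨ ι-* (ℤ.+ d) a ⟩
  ι (ℤ.+ d) ℚ.* ι a                     ≡⟨ cong (λ x → ι (ℤ.+ d) ℚ.* x) (trans eq (/≡ι*recip b d)) ⟩
  ι (ℤ.+ d) ℚ.* (ι b ℚ.* recip d)       ≡⟨ solve 3 (λ x y z → x :* (y :* z) := y :* (x :* z)) refl (ι (ℤ.+ d)) (ι b) (recip d) ⟩
  ι b ℚ.* (ι (ℤ.+ d) ℚ.* recip d)       ≡⟨ cong (λ x → ι b ℚ.* x) (ι*recip≡1 d) ⟩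
  ι b ℚ.* 1ℚ                            ≡⟨ ℚ.*-identityʳ (ι b) ⟩
  ι b                                   ∎)
  where open ≡-Reasoning

recip-nonNeg : ∀ d .{{_ : NonZero d}} → ℚ.NonNegative (recip d)
recip-nonNeg d = ℚ.normalize-nonNeg 1 d

0≤ι*recip : ∀ {z} d .{{_ : NonZero d}} → ℤ.0ℤ ℤ.≤ z → 0ℚ ℚ.≤ ι z ℚ.* recip d
0≤ι*recip {z} d 0≤z = subst (ℚ._≤ ι z ℚ.* recip d) (ℚ.*-zeroˡ (recip d))
  (ℚ.*-monoʳ-≤-nonNeg (recip d) {{recip-nonNeg d}} (ι-mono-≤ 0≤z))

-- Null sequences of rationals

Null : (ℕ → ℚ) → Set
Null u = ∀ ε → 0ℚ ℚ.< ε → ∃ λ N → ∀ m → N ℕ.≤ m → ℚ.∣ u m ∣ ℚ.< ε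

null-cong : ∀ {u v} → u ≗ v → Null u → Null v
null-cong u≗v null-u ε 0<ε with null-u ε 0<ε
... | N , small = N , λ m N≤m → subst (λ x → ℚ.∣ x ∣ ℚ.< ε) (u≗v m) (small m N≤m)

null-0 : Null (λ _ → 0ℚ)
null-0 ε 0<ε = 0 , λ _ _ → 0<ε

null-neg : ∀ {u} → Null u → Null (λ m → ℚ.- u m)
null-neg {u} null-u ε 0<ε with null-u ε 0<ε
... | N , small = N , λ m N≤m → subst (ℚ._< ε) (sym (ℚ.∣-p∣≡∣p∣ (u m))) (small m N≤m)

null-+ : ∀ {u v} → Null u → Null v → Null (λ m → u m ℚ.+ v m)
null-+ {u} {v} null-u null-v ε 0<ε
  with null-u (ε ℚ.* ½) (ℚ.*-monoˡ-<-pos ½ 0<ε) | null-v (ε ℚ.* ½) (ℚ.*-monoˡ-<-pos ½ 0<ε)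
... | N₁ , small₁ | N₂ , small₂ = N₁ ℕ.⊔ N₂ , λ m N≤m → begin-strict
  ℚ.∣ u m ℚ.+ v m ∣                ≤⟨ ℚ.∣p+q∣≤∣p∣+∣q∣ (u m) (v m) ⟩
  ℚ.∣ u m ∣ ℚ.+ ℚ.∣ v m ∣          <⟨ ℚ.+-mono-< (small₁ m (ℕ.m⊔n≤o⇒m≤o N₁ N₂ N≤m)) (small₂ m (ℕ.m⊔n≤o⇒n≤o N₁ N₂ N≤m)) ⟩
  ε ℚ.* ½ ℚ.+ ε ℚ.* ½              ≡⟨ ℚ.*-distribˡ-+ ε ½ ½ ⟨
  ε ℚ.* 1ℚ                         ≡⟨ ℚ.*-identityʳ ε ⟩
  ε                                ∎
  where open ℚ.≤-Reasoning

null-* : ∀ {u v} → Null u → Null v → Null (λ m → u m ℚ.* v m)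
null-* {u} {v} null-u null-v ε 0<ε
  with null-u ε 0<ε | null-v 1ℚ (ℚ.positive⁻¹ 1ℚ)
... | N₁ , small₁ | N₂ , small₂ = N₁ ℕ.⊔ N₂ , λ m N≤m → begin-strict
  ℚ.∣ u m ℚ.* v m ∣                ≡⟨ ℚ.∣p*q∣≡∣p∣*∣q∣ (u m) (v m) ⟩
  ℚ.∣ u m ∣ ℚ.* ℚ.∣ v m ∣          ≤⟨ ℚ.*-monoˡ-≤-nonNeg ℚ.∣ u m ∣ {{ℚ.∣-∣-nonNeg (u m)}}
                                        (ℚ.<⇒≤ (small₂ m (ℕ.m⊔n≤o⇒n≤o N₁ N₂ N≤m))) ⟩
  ℚ.∣ u m ∣ ℚ.* 1ℚ                 ≡⟨ ℚ.*-identityʳ ℚ.∣ u m ∣ ⟩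
  ℚ.∣ u m ∣                        <⟨ small₁ m (ℕ.m⊔n≤o⇒m≤o N₁ N₂ N≤m) ⟩
  ε                                ∎
  where open ℚ.≤-Reasoning

null-ι+* : ∀ n {u} → Null u → Null (λ m → ι (ℤ.+ n) ℚ.* u m)
null-ι+* zero    {u} null-u = null-cong (λ m → sym (ℚ.*-zeroˡ (u m))) null-0
null-ι+* (suc n) {u} null-u = null-cong
  (λ m → sym (trans (cong (ℚ._* u m) (ι-+ ℤ.1ℤ (ℤ.+ n)))
    (solve 2 (λ x y → (con 1ℚ :+ x) :* y := y :+ x :* y) refl (ι (ℤ.+ n)) (u m))))
  (null-+ null-u (null-ι+* n null-u))

null-ι* : ∀ z {u} → Null u → Null (λ m → ι z ℚ.* u m)
null-ι* (ℤ.+ n)    null-u = null-ι+* n null-u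
null-ι* ℤ.-[1+ n ] {u} null-u = null-cong
  (λ m → sym (trans (cong (ℚ._* u m) (ι-neg (ℤ.+ suc n))) (sym (ℚ.neg-distribˡ-* (ι (ℤ.+ suc n)) (u m)))))
  (null-neg (null-ι+* (suc n) null-u))

null-const : ∀ {x} → Null (λ _ → x) → x ≡ 0ℚ
null-const {x} null-x with x ℚ.≟ 0ℚ
... | yes x≡0 = x≡0
... | no  x≢0 with null-x ℚ.∣ x ∣ (ℚ.≰⇒> λ ∣x∣≤0 → x≢0 (ℚ.∣p∣≡0⇒p≡0 x (ℚ.≤-antisym ∣x∣≤0 (ℚ.0≤∣p∣ x))))
...   | N , small = contradiction (small N ℕ.≤-refl) (ℚ.<-irrefl refl)

null-squeeze : ∀ {u v} → (∀ m → 0ℚ ℚ.≤ u m) → (∀ m → u m ℚ.≤ v m) → Null v → Null u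
null-squeeze {u} {v} 0≤u u≤v null-v ε 0<ε with null-v ε 0<ε
... | N , small = N , λ m N≤m → begin-strict
  ℚ.∣ u m ∣      ≡⟨ ℚ.0≤p⇒∣p∣≡p (0≤u m) ⟩
  u m            ≤⟨ u≤v m ⟩
  v m            ≡⟨ ℚ.0≤p⇒∣p∣≡p (ℚ.≤-trans (0≤u m) (u≤v m)) ⟨
  ℚ.∣ v m ∣      <⟨ small m N≤m ⟩
  ε              ∎
  where open ℚ.≤-Reasoning

null-recip : Null (λ m → recip (suc m))
null-recip ε 0<ε with archimedean ε 0<ε
... | N , small = N , λ m N≤m →
  subst (ℚ._< ε) (sym (ℚ.0≤p⇒∣p∣≡p (ℚ.nonNegative⁻¹ (recip (suc m)) {{recip-nonNeg (suc m)}}))) (small m N≤m)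

-- Rational approximations of √n

*-cancel-square-≤ : ∀ {a b} → a * a ℕ.≤ b * b → a ℕ.≤ b
*-cancel-square-≤ {a} {b} aa≤bb with a ℕ.≤? b
... | yes a≤b = a≤b
... | no  a≰b = contradiction aa≤bb (ℕ.<⇒≱ (ℕ.*-mono-< (ℕ.≰⇒> a≰b) (ℕ.≰⇒> a≰b)))

isqrt-square : ∀ n → isqrt (n * n) ≡ n
isqrt-square n = ℕ.≤-antisym (*-cancel-square-≤ (isqrt-lower (n * n)))
  (ℕ.≮⇒≥ λ lt → ℕ.<⇒≱ (isqrt-upper (n * n)) (ℕ.*-mono-≤ lt lt))

√-seq-square : ∀ d m → √-seq (d * d) m ≡ ι (ℤ.+ d)
√-seq-square d m = begin
  √-seq (d * d) m                                        ≡⟨ cong (λ r → ℤ.+ r ℚ./ suc m) (trans (cong isqrt (interchange d (suc m))) (isqrt-square (d * suc m))) ⟩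
  ℤ.+ (d * suc m) ℚ./ suc m                              ≡⟨ /≡ι*recip (ℤ.+ (d * suc m)) (suc m) ⟩
  ι (ℤ.+ (d * suc m)) ℚ.* recip (suc m)                  ≡⟨ cong (ℚ._* recip (suc m)) (trans (cong ι (ℤ.pos-* d (suc m))) (ι-* (ℤ.+ d) (ℤ.+ suc m))) ⟩
  ι (ℤ.+ d) ℚ.* ι (ℤ.+ suc m) ℚ.* recip (suc m)          ≡⟨ ℚ.*-assoc (ι (ℤ.+ d)) (ι (ℤ.+ suc m)) (recip (suc m)) ⟩
  ι (ℤ.+ d) ℚ.* (ι (ℤ.+ suc m) ℚ.* recip (suc m))        ≡⟨ cong (λ x → ι (ℤ.+ d) ℚ.* x) (ι*recip≡1 (suc m)) ⟩
  ι (ℤ.+ d) ℚ.* 1ℚ                                       ≡⟨ ℚ.*-identityʳ (ι (ℤ.+ d)) ⟩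
  ι (ℤ.+ d)                                              ∎
  where
  open ≡-Reasoning
  interchange : ∀ a b → a * a * (b * b) ≡ a * b * (a * b)
  interchange = ℕR.solve-∀

module _ (n m : ℕ) where
  private
    r : ℕ
    r = isqrt (n * (suc m * suc m))
    R M δ : ℚ
    R = ι (ℤ.+ r)
    M = ι (ℤ.+ suc m)
    δ = recip (suc m)
    √≡ : √-seq n m ≡ R ℚ.* δ
    √≡ = /≡ι*recip (ℤ.+ r) (suc m)
    unscale : ∀ x → x ≡ x ℚ.* M ℚ.* δ
    unscale x = sym (trans (ℚ.*-assoc x M δ) (trans (cong (λ y → x ℚ.* y) (ι*recip≡1 (suc m))) (ℚ.*-identityʳ x)))
    gap : ℤ
    gap = ℤ.+ n ℤ.* (ℤ.+ suc m ℤ.* ℤ.+ suc m) ℤ.- ℤ.+ r ℤ.* ℤ.+ r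
    pos-nM² : ℤ.+ (n * (suc m * suc m)) ≡ ℤ.+ n ℤ.* (ℤ.+ suc m ℤ.* ℤ.+ suc m)
    pos-nM² = trans (ℤ.pos-* n (suc m * suc m)) (cong (λ y → ℤ.+ n ℤ.* y) (ℤ.pos-* (suc m) (suc m)))

    0≤gap : ℤ.0ℤ ℤ.≤ gap
    0≤gap = ℤ.i≤j⇒0≤j-i (subst₂ ℤ._≤_ (ℤ.pos-* r r) pos-nM² (ℤ.+≤+ (isqrt-lower (n * (suc m * suc m)))))

    r≤nM : r ℕ.≤ n * suc m
    r≤nM = *-cancel-square-≤ (ℕ.≤-trans (isqrt-lower (n * (suc m * suc m))) (ℕ.≤-trans
      (ℕ.*-monoˡ-≤ (suc m * suc m) (n≤n*n n)) (ℕ.≤-reflexive (interchange n (suc m)))))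
      where
      n≤n*n : ∀ n → n ℕ.≤ n * n
      n≤n*n zero    = ℕ.z≤n
      n≤n*n (suc n) = ℕ.m≤m+n (suc n) (n * suc n)
      interchange : ∀ a b → a * a * (b * b) ≡ a * b * (a * b)
      interchange = ℕR.solve-∀

    gap≤2nM : gap ℤ.≤ (ℤ.+ n ℤ.+ ℤ.+ n) ℤ.* ℤ.+ suc m
    gap≤2nM = begin
      ℤ.+ n ℤ.* (ℤ.+ suc m ℤ.* ℤ.+ suc m) ℤ.- ℤ.+ r ℤ.* ℤ.+ r
        ≡⟨ cong₂ ℤ._-_ pos-nM² (ℤ.pos-* r r) ⟨
      ℤ.+ (n * (suc m * suc m)) ℤ.- ℤ.+ (r * r)
        ≤⟨ ℤ.+-monoˡ-≤ (ℤ.- ℤ.+ (r * r)) (ℤ.+≤+ upper) ⟩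
      ℤ.+ (r * r ℕ.+ (n * suc m ℕ.+ n * suc m)) ℤ.- ℤ.+ (r * r)
        ≡⟨ cong (λ y → y ℤ.- ℤ.+ (r * r)) (ℤ.pos-+ (r * r) (n * suc m ℕ.+ n * suc m)) ⟩
      ℤ.+ (r * r) ℤ.+ ℤ.+ (n * suc m ℕ.+ n * suc m) ℤ.- ℤ.+ (r * r)
        ≡⟨ cancel (ℤ.+ (r * r)) (ℤ.+ (n * suc m ℕ.+ n * suc m)) ⟩
      ℤ.+ (n * suc m ℕ.+ n * suc m)
        ≡⟨ cong ℤ.+_ (ℕ.*-distribʳ-+ (suc m) n n) ⟨
      ℤ.+ ((n ℕ.+ n) * suc m)
        ≡⟨ ℤ.pos-* (n ℕ.+ n) (suc m) ⟩
      ℤ.+ (n ℕ.+ n) ℤ.* ℤ.+ suc m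
        ≡⟨ cong (λ y → y ℤ.* ℤ.+ suc m) (ℤ.pos-+ n n) ⟩
      (ℤ.+ n ℤ.+ ℤ.+ n) ℤ.* ℤ.+ suc m ∎
      where
      open ℤ.≤-Reasoning
      cancel : ∀ x y → x ℤ.+ y ℤ.- x ≡ y
      cancel = ℤR.solve-∀
      expand : ∀ r → suc r * suc r ≡ suc (r * r ℕ.+ (r ℕ.+ r))
      expand = ℕR.solve-∀
      upper : n * (suc m * suc m) ℕ.≤ r * r ℕ.+ (n * suc m ℕ.+ n * suc m)
      upper = ℕ.≤-trans (ℕ.s≤s⁻¹ (subst (n * (suc m * suc m) ℕ.<_) (expand r) (isqrt-upper (n * (suc m * suc m)))))
        (ℕ.+-monoʳ-≤ (r * r) (ℕ.+-mono-≤ r≤nM r≤nM))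

    defect : ι (ℤ.+ n) ℚ.- √-seq n m ℚ.* √-seq n m ≡ ι gap ℚ.* δ ℚ.* δ
    defect = begin
      N ℚ.- √-seq n m ℚ.* √-seq n m
        ≡⟨ cong₂ ℚ._-_ (trans (unscale N) (cong (ℚ._* δ) (cong (ℚ._* M) (unscale N)))) (cong₂ ℚ._*_ √≡ √≡) ⟩
      N ℚ.* M ℚ.* δ ℚ.* M ℚ.* δ ℚ.- R ℚ.* δ ℚ.* (R ℚ.* δ)
        ≡⟨ solve 4 (λ N M R δ → N :* M :* δ :* M :* δ :- R :* δ :* (R :* δ) := (N :* (M :* M) :- R :* R) :* δ :* δ) refl N M R δ ⟩
      (N ℚ.* (M ℚ.* M) ℚ.- R ℚ.* R) ℚ.* δ ℚ.* δ
        ≡⟨ cong (λ y → y ℚ.* δ ℚ.* δ) (trans (ι-- (ℤ.+ n ℤ.* (ℤ.+ suc m ℤ.* ℤ.+ suc m)) (ℤ.+ r ℤ.* ℤ.+ r))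
             (cong₂ ℚ._-_ (trans (ι-* (ℤ.+ n) (ℤ.+ suc m ℤ.* ℤ.+ suc m)) (cong (λ y → N ℚ.* y) (ι-* (ℤ.+ suc m) (ℤ.+ suc m)))) (ι-* (ℤ.+ r) (ℤ.+ r)))) ⟨
      ι gap ℚ.* δ ℚ.* δ ∎
      where
      open ≡-Reasoning
      N : ℚ
      N = ι (ℤ.+ n)

  √-defect-lower : 0ℚ ℚ.≤ ι (ℤ.+ n) ℚ.- √-seq n m ℚ.* √-seq n m
  √-defect-lower = subst (0ℚ ℚ.≤_) (sym defect) (subst (ℚ._≤ ι gap ℚ.* δ ℚ.* δ) (ℚ.*-zeroˡ δ)
    (ℚ.*-monoʳ-≤-nonNeg δ {{recip-nonNeg (suc m)}} (0≤ι*recip (suc m) 0≤gap)))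

  √-defect-upper : ι (ℤ.+ n) ℚ.- √-seq n m ℚ.* √-seq n m ℚ.≤ ι (ℤ.+ n ℤ.+ ℤ.+ n) ℚ.* recip (suc m)
  √-defect-upper = begin
    ι (ℤ.+ n) ℚ.- √-seq n m ℚ.* √-seq n m                  ≡⟨ defect ⟩
    ι gap ℚ.* δ ℚ.* δ                                      ≤⟨ ℚ.*-monoʳ-≤-nonNeg δ {{recip-nonNeg (suc m)}} (ℚ.*-monoʳ-≤-nonNeg δ {{recip-nonNeg (suc m)}} (ι-mono-≤ gap≤2nM)) ⟩
    ι ((ℤ.+ n ℤ.+ ℤ.+ n) ℤ.* ℤ.+ suc m) ℚ.* δ ℚ.* δ        ≡⟨ cong (λ y → y ℚ.* δ ℚ.* δ) (ι-* (ℤ.+ n ℤ.+ ℤ.+ n) (ℤ.+ suc m)) ⟩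
    ι (ℤ.+ n ℤ.+ ℤ.+ n) ℚ.* M ℚ.* δ ℚ.* δ                  ≡⟨ cong (ℚ._* δ) (unscale (ι (ℤ.+ n ℤ.+ ℤ.+ n))) ⟨
    ι (ℤ.+ n ℤ.+ ℤ.+ n) ℚ.* δ                              ∎
    where open ℚ.≤-Reasoning

  √-majorises : ∀ e q → e ℤ.* e ℤ.≤ ℤ.+ n ℤ.* (ℤ.+ q ℤ.* ℤ.+ q) →
                0ℚ ℚ.≤ ι e ℚ.+ ι (ℤ.+ q) ℚ.* (√-seq n m ℚ.+ recip (suc m))
  √-majorises e q e²≤nq² = subst (0ℚ ℚ.≤_) eq (0≤ι*recip (suc m) 0≤num)
    where
    num : ℤ
    num = e ℤ.* ℤ.+ suc m ℤ.+ ℤ.+ q ℤ.* (ℤ.+ r ℤ.+ ℤ.1ℤ)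
    a : ℕ
    a = ℤ.∣ e ∣
    a²≤nq² : a * a ℕ.≤ n * (q * q)
    a²≤nq² = ℤ.drop‿+≤+ (subst₂ ℤ._≤_ (i*i≡+∣i∣² e)
      (sym (trans (ℤ.pos-* n (q * q)) (cong (λ y → ℤ.+ n ℤ.* y) (ℤ.pos-* q q)))) e²≤nq²)
    aM≤q[1+r] : a * suc m ℕ.≤ q * suc r
    aM≤q[1+r] = *-cancel-square-≤ (begin
      a * suc m * (a * suc m)              ≡⟨ interchange a (suc m) ⟩
      a * a * (suc m * suc m)              ≤⟨ ℕ.*-monoˡ-≤ (suc m * suc m) a²≤nq² ⟩
      n * (q * q) * (suc m * suc m)        ≡⟨ swap n (q * q) (suc m * suc m) ⟩
      q * q * (n * (suc m * suc m))        ≤⟨ ℕ.*-monoʳ-≤ (q * q) (ℕ.<⇒≤ (isqrt-upper (n * (suc m * suc m)))) ⟩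
      q * q * (suc r * suc r)              ≡⟨ interchange q (suc r) ⟨
      q * suc r * (q * suc r)              ∎)
      where
      open ℕ.≤-Reasoning
      interchange : ∀ a b → a * b * (a * b) ≡ a * a * (b * b)
      interchange = ℕR.solve-∀
      swap : ∀ a b c → a * b * c ≡ b * (a * c)
      swap = ℕR.solve-∀
    0≤∣i∣+i : ∀ i → ℤ.0ℤ ℤ.≤ ℤ.+ ℤ.∣ i ∣ ℤ.+ i
    0≤∣i∣+i (ℤ.+ k)    = ℤ.+≤+ ℕ.z≤n
    0≤∣i∣+i ℤ.-[1+ k ] = ℤ.≤-reflexive (sym (ℤ.+-inverseʳ (ℤ.+ suc k)))
    0≤num : ℤ.0ℤ ℤ.≤ num
    0≤num = begin
      ℤ.0ℤ                                         ≡⟨⟩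
      ℤ.0ℤ ℤ.* ℤ.+ suc m                           ≤⟨ ℤ.*-monoʳ-≤-nonNeg (ℤ.+ suc m) (0≤∣i∣+i e) ⟩
      (ℤ.+ a ℤ.+ e) ℤ.* ℤ.+ suc m                  ≡⟨ distrib (ℤ.+ a) e (ℤ.+ suc m) ⟩
      e ℤ.* ℤ.+ suc m ℤ.+ ℤ.+ a ℤ.* ℤ.+ suc m      ≡⟨ cong (λ y → e ℤ.* ℤ.+ suc m ℤ.+ y) (ℤ.pos-* a (suc m)) ⟨
      e ℤ.* ℤ.+ suc m ℤ.+ ℤ.+ (a * suc m)          ≤⟨ ℤ.+-monoʳ-≤ (e ℤ.* ℤ.+ suc m) (ℤ.+≤+ aM≤q[1+r]) ⟩
      e ℤ.* ℤ.+ suc m ℤ.+ ℤ.+ (q * suc r)          ≡⟨ cong (λ y → e ℤ.* ℤ.+ suc m ℤ.+ y) (trans (ℤ.pos-* q (suc r)) (cong (λ y → ℤ.+ q ℤ.* y) (ℤ.+-comm ℤ.1ℤ (ℤ.+ r)))) ⟩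
      num                                          ∎
      where
      open ℤ.≤-Reasoning
      distrib : ∀ a e M → (a ℤ.+ e) ℤ.* M ≡ e ℤ.* M ℤ.+ a ℤ.* M
      distrib = ℤR.solve-∀
    eq : ι num ℚ.* δ ≡ ι e ℚ.+ ι (ℤ.+ q) ℚ.* (√-seq n m ℚ.+ δ)
    eq = begin
      ι num ℚ.* δ
        ≡⟨ cong (ℚ._* δ) (trans (ι-+ (e ℤ.* ℤ.+ suc m) (ℤ.+ q ℤ.* (ℤ.+ r ℤ.+ ℤ.1ℤ)))
             (cong₂ ℚ._+_ (ι-* e (ℤ.+ suc m)) (trans (ι-* (ℤ.+ q) (ℤ.+ r ℤ.+ ℤ.1ℤ)) (cong (λ y → ι (ℤ.+ q) ℚ.* y) (ι-+ (ℤ.+ r) ℤ.1ℤ))))) ⟩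
      (ι e ℚ.* M ℚ.+ ι (ℤ.+ q) ℚ.* (R ℚ.+ 1ℚ)) ℚ.* δ
        ≡⟨ solve 5 (λ E M Q R δ → (E :* M :+ Q :* (R :+ con 1ℚ)) :* δ := E :* M :* δ :+ Q :* (R :* δ :+ δ)) refl (ι e) M (ι (ℤ.+ q)) R δ ⟩
      ι e ℚ.* M ℚ.* δ ℚ.+ ι (ℤ.+ q) ℚ.* (R ℚ.* δ ℚ.+ δ)
        ≡⟨ cong₂ (λ x y → x ℚ.+ ι (ℤ.+ q) ℚ.* (y ℚ.+ δ)) (unscale (ι e)) √≡ ⟨
      ι e ℚ.+ ι (ℤ.+ q) ℚ.* (√-seq n m ℚ.+ δ) ∎
      where open ≡-Reasoning

√-defect-null : ∀ n → Null (λ m → ι (ℤ.+ n) ℚ.- √-seq n m ℚ.* √-seq n m)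
√-defect-null n = null-squeeze (√-defect-lower n) (√-defect-upper n) (null-ι* (ℤ.+ n ℤ.+ ℤ.+ n) null-recip)

-- Distance to the bounds

i+j≡0⇒i≡-j : ∀ i j → i ℤ.+ j ≡ ℤ.0ℤ → i ≡ ℤ.- j
i+j≡0⇒i≡-j i j eq = trans (rearrange i j) (trans (cong (λ k → k ℤ.- j) eq) (ℤ.+-identityˡ (ℤ.- j)))
  where
  rearrange : ∀ i j → i ≡ i ℤ.+ j ℤ.- j
  rearrange = ℤR.solve-∀

≤ᵣ-intro : ∀ {x y} → (∀ m → 0ℚ ℚ.≤ seq y m ℚ.- seq x m ℚ.+ recip (suc m)) → x ≤ᵣ y
≤ᵣ-intro {x} {y} 0≤gap ε 0<ε with archimedean ε 0<ε
... | N , small = N , λ m N≤m → begin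
  seq x m                                                      ≡⟨ ℚ.+-identityʳ (seq x m) ⟨
  seq x m ℚ.+ 0ℚ                                               ≤⟨ ℚ.+-monoʳ-≤ (seq x m) (0≤gap m) ⟩
  seq x m ℚ.+ (seq y m ℚ.- seq x m ℚ.+ recip (suc m))          ≡⟨ solve 3 (λ a b c → a :+ (b :- a :+ c) := b :+ c) refl (seq x m) (seq y m) (recip (suc m)) ⟩
  seq y m ℚ.+ recip (suc m)                                    ≤⟨ ℚ.+-monoʳ-≤ (seq y m) (ℚ.<⇒≤ (small m N≤m)) ⟩
  seq y m ℚ.+ ε                                                ∎
  where open ℚ.≤-Reasoning

≃ᵣ-pointwise : ∀ {x y} → (∀ m → seq x m ℚ.- seq y m ≡ 0ℚ) → x ≃ᵣ y
≃ᵣ-pointwise eq = null-cong (sym ∘ eq) null-0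

-- The m-th approximation of k − lower for e = deviation n h k, and of upper − k
-- for e = − deviation n h k.
margin : (n h : ℕ) .{{_ : NonZero h}} → ℤ → ℕ → ℚ
margin n h e m = (ι e ℚ.+ ι (ℤ.+ pred h) ℚ.* √-seq n m) ℚ.* recip h

module _ (n h : ℕ) .{{_ : NonZero h}} where
  private
    q : ℕ
    q = pred h
    N c Q : ℚ
    N = ι (ℤ.+ n)
    c = recip h
    Q = ι (ℤ.+ q)

    ιh≡1+Q : ι (ℤ.+ h) ≡ 1ℚ ℚ.+ Q
    ιh≡1+Q = trans (cong (λ h → ι (ℤ.+ h)) (sym (ℕ.suc-pred h))) (ι-+ ℤ.1ℤ (ℤ.+ q))

    [1+Q]c≡1 : (1ℚ ℚ.+ Q) ℚ.* c ≡ 1ℚ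
    [1+Q]c≡1 = trans (cong (ℚ._* c) (sym ιh≡1+Q)) (ι*recip≡1 h)

    unscale : ∀ x → x ≡ x ℚ.* ((1ℚ ℚ.+ Q) ℚ.* c)
    unscale x = sym (trans (cong (λ y → x ℚ.* y) [1+Q]c≡1) (ℚ.*-identityʳ x))

    ι-deviation : ∀ k → ι (deviation n h k) ≡ (1ℚ ℚ.+ Q) ℚ.* ι (ℤ.+ k) ℚ.- N
    ι-deviation k = trans (ι-- (ℤ.+ h ℤ.* ℤ.+ k) (ℤ.+ n))
      (cong (ℚ._- N) (trans (ι-* (ℤ.+ h) (ℤ.+ k)) (cong (ℚ._* ι (ℤ.+ k)) ιh≡1+Q)))

  margin-lower : ∀ k m → let s = √-seq n m in
    ι (ℤ.+ k) ℚ.- (N ℚ.* c ℚ.- s ℚ.+ s ℚ.* c) ≡ margin n h (deviation n h k) m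
  margin-lower k m = begin
    K ℚ.- (N ℚ.* c ℚ.- s ℚ.+ s ℚ.* c)
      ≡⟨ cong₂ (λ K s′ → K ℚ.- (N ℚ.* c ℚ.- s′ ℚ.+ s ℚ.* c)) (unscale K) (unscale s) ⟩
    K ℚ.* ((1ℚ ℚ.+ Q) ℚ.* c) ℚ.- (N ℚ.* c ℚ.- s ℚ.* ((1ℚ ℚ.+ Q) ℚ.* c) ℚ.+ s ℚ.* c)
      ≡⟨ solve 5 (λ K Q c N s → K :* ((con 1ℚ :+ Q) :* c) :- (N :* c :- s :* ((con 1ℚ :+ Q) :* c) :+ s :* c)
           := ((con 1ℚ :+ Q) :* K :- N :+ Q :* s) :* c) refl K Q c N s ⟩
    ((1ℚ ℚ.+ Q) ℚ.* K ℚ.- N ℚ.+ Q ℚ.* s) ℚ.* c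
      ≡⟨ cong (λ d → (d ℚ.+ Q ℚ.* s) ℚ.* c) (ι-deviation k) ⟨
    margin n h (deviation n h k) m ∎
    where
    open ≡-Reasoning
    K s : ℚ
    K = ι (ℤ.+ k)
    s = √-seq n m

  margin-upper : ∀ k m → let s = √-seq n m in
    (N ℚ.* c ℚ.+ s ℚ.- s ℚ.* c) ℚ.- ι (ℤ.+ k) ≡ margin n h (ℤ.- deviation n h k) m
  margin-upper k m = begin
    (N ℚ.* c ℚ.+ s ℚ.- s ℚ.* c) ℚ.- K
      ≡⟨ cong₂ (λ K s′ → (N ℚ.* c ℚ.+ s′ ℚ.- s ℚ.* c) ℚ.- K) (unscale K) (unscale s) ⟩
    (N ℚ.* c ℚ.+ s ℚ.* ((1ℚ ℚ.+ Q) ℚ.* c) ℚ.- s ℚ.* c) ℚ.- K ℚ.* ((1ℚ ℚ.+ Q) ℚ.* c)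
      ≡⟨ solve 5 (λ K Q c N s → (N :* c :+ s :* ((con 1ℚ :+ Q) :* c) :- s :* c) :- K :* ((con 1ℚ :+ Q) :* c)
           := (:- ((con 1ℚ :+ Q) :* K :- N) :+ Q :* s) :* c) refl K Q c N s ⟩
    (ℚ.- ((1ℚ ℚ.+ Q) ℚ.* K ℚ.- N) ℚ.+ Q ℚ.* s) ℚ.* c
      ≡⟨ cong (λ d → (d ℚ.+ Q ℚ.* s) ℚ.* c) (trans (ι-neg (deviation n h k)) (cong ℚ.-_ (ι-deviation k))) ⟨
    margin n h (ℤ.- deviation n h k) m ∎
    where
    open ≡-Reasoning
    K s : ℚ
    K = ι (ℤ.+ k)
    s = √-seq n m

  centred-deviation : ∀ k t → ι (deviation n h k) ≡ t → ι (ℤ.+ k) ℚ.- (N ℚ.* c ℚ.+ t ℚ.* c) ≡ 0ℚ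
  centred-deviation k t eq = begin
    K ℚ.- (N ℚ.* c ℚ.+ t ℚ.* c)
      ≡⟨ cong₂ (λ K t → K ℚ.- (N ℚ.* c ℚ.+ t ℚ.* c)) (unscale K) (trans (sym eq) (ι-deviation k)) ⟩
    K ℚ.* ((1ℚ ℚ.+ Q) ℚ.* c) ℚ.- (N ℚ.* c ℚ.+ ((1ℚ ℚ.+ Q) ℚ.* K ℚ.- N) ℚ.* c)
      ≡⟨ solve 4 (λ K Q c N → K :* ((con 1ℚ :+ Q) :* c) :- (N :* c :+ ((con 1ℚ :+ Q) :* K :- N) :* c) := con 0ℚ) refl K Q c N ⟩
    0ℚ ∎
    where
    open ≡-Reasoning
    K : ℚ
    K = ι (ℤ.+ k)

  0≤margin+recip : ∀ e → e ℤ.* e ℤ.≤ ℤ.+ n ℤ.* (ℤ.+ q ℤ.* ℤ.+ q) → ∀ m → 0ℚ ℚ.≤ margin n h e m ℚ.+ recip (suc m)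
  0≤margin+recip e e²≤nq² m = begin
    0ℚ
      ≡⟨ ℚ.*-zeroˡ c ⟨
    0ℚ ℚ.* c
      ≤⟨ ℚ.*-monoʳ-≤-nonNeg c {{recip-nonNeg h}} (√-majorises n m e q e²≤nq²) ⟩
    (ι e ℚ.+ Q ℚ.* (√-seq n m ℚ.+ δ)) ℚ.* c
      ≡⟨ solve 5 (λ E Q s δ c → (E :+ Q :* (s :+ δ)) :* c := (E :+ Q :* s) :* c :+ ((con 1ℚ :+ Q) :* c :* δ :- c :* δ)) refl (ι e) Q (√-seq n m) δ c ⟩
    margin n h e m ℚ.+ ((1ℚ ℚ.+ Q) ℚ.* c ℚ.* δ ℚ.- c ℚ.* δ)
      ≡⟨ cong (λ y → margin n h e m ℚ.+ (y ℚ.* δ ℚ.- c ℚ.* δ)) [1+Q]c≡1 ⟩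
    margin n h e m ℚ.+ (1ℚ ℚ.* δ ℚ.- c ℚ.* δ)
      ≡⟨ solve 3 (λ a c δ → a :+ (con 1ℚ :* δ :- c :* δ) := a :+ δ :+ (:- (c :* δ))) refl (margin n h e m) c δ ⟩
    margin n h e m ℚ.+ δ ℚ.- c ℚ.* δ
      ≤⟨ ℚ.+-monoʳ-≤ (margin n h e m ℚ.+ δ) (ℚ.neg-antimono-≤ (subst (ℚ._≤ c ℚ.* δ) (ℚ.*-zeroˡ δ)
           (ℚ.*-monoʳ-≤-nonNeg δ {{recip-nonNeg (suc m)}} (ℚ.nonNegative⁻¹ c {{recip-nonNeg h}})))) ⟩
    margin n h e m ℚ.+ δ ℚ.+ 0ℚ
      ≡⟨ ℚ.+-identityʳ (margin n h e m ℚ.+ δ) ⟩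
    margin n h e m ℚ.+ δ ∎
    where
    open ℚ.≤-Reasoning
    δ : ℚ
    δ = recip (suc m)

  numerator : ∀ e m → ι (ℤ.+ h) ℚ.* margin n h e m ≡ ι e ℚ.+ Q ℚ.* √-seq n m
  numerator e m = begin
    ι (ℤ.+ h) ℚ.* (x ℚ.* c)      ≡⟨ solve 3 (λ h x c → h :* (x :* c) := x :* (h :* c)) refl (ι (ℤ.+ h)) x c ⟩
    x ℚ.* (ι (ℤ.+ h) ℚ.* c)      ≡⟨ cong (λ y → x ℚ.* y) (ι*recip≡1 h) ⟩
    x ℚ.* 1ℚ                     ≡⟨ ℚ.*-identityʳ x ⟩
    x                            ∎
    where
    open ≡-Reasoning
    x : ℚ
    x = ι e ℚ.+ Q ℚ.* √-seq n m

  -- With w = e + q s → 0 and s² → n: e² − q²n = 2e w − w² − q²(n − s²) is a constant null sequence.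
  null-margin⇒square : ∀ e → Null (margin n h e) → e ℤ.* e ≡ ℤ.+ n ℤ.* (ℤ.+ q ℤ.* ℤ.+ q)
  null-margin⇒square e null-e = ℤ.i-j≡0⇒i≡j _ _ (ι-injective (null-const (null-cong identity
    (null-+ (null-+ (null-ι* (e ℤ.+ e) null-w) (null-neg (null-* null-w null-w)))
            (null-neg (null-ι* (ℤ.+ q ℤ.* ℤ.+ q) (√-defect-null n)))))))
    where
    w : ℕ → ℚ
    w m = ι e ℚ.+ Q ℚ.* √-seq n m
    null-w : Null w
    null-w = null-cong (numerator e) (null-ι* (ℤ.+ h) null-e)
    identity : ∀ m → ι (e ℤ.+ e) ℚ.* w m ℚ.- w m ℚ.* w m ℚ.- ι (ℤ.+ q ℤ.* ℤ.+ q) ℚ.* (N ℚ.- √-seq n m ℚ.* √-seq n m)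
                   ≡ ι (e ℤ.* e ℤ.- ℤ.+ n ℤ.* (ℤ.+ q ℤ.* ℤ.+ q))
    identity m = begin
      ι (e ℤ.+ e) ℚ.* w m ℚ.- w m ℚ.* w m ℚ.- ι (ℤ.+ q ℤ.* ℤ.+ q) ℚ.* (N ℚ.- s ℚ.* s)
        ≡⟨ cong₂ (λ x y → x ℚ.* w m ℚ.- w m ℚ.* w m ℚ.- y ℚ.* (N ℚ.- s ℚ.* s)) (ι-+ e e) (ι-* (ℤ.+ q) (ℤ.+ q)) ⟩
      (ι e ℚ.+ ι e) ℚ.* w m ℚ.- w m ℚ.* w m ℚ.- Q ℚ.* Q ℚ.* (N ℚ.- s ℚ.* s)
        ≡⟨ solve 4 (λ E Q s N → (E :+ E) :* (E :+ Q :* s) :- (E :+ Q :* s) :* (E :+ Q :* s) :- Q :* Q :* (N :- s :* s)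
             := E :* E :- N :* (Q :* Q)) refl (ι e) Q s N ⟩
      ι e ℚ.* ι e ℚ.- N ℚ.* (Q ℚ.* Q)
        ≡⟨ trans (ι-- (e ℤ.* e) (ℤ.+ n ℤ.* (ℤ.+ q ℤ.* ℤ.+ q))) (cong₂ ℚ._-_ (ι-* e e)
             (trans (ι-* (ℤ.+ n) (ℤ.+ q ℤ.* ℤ.+ q)) (cong (λ y → N ℚ.* y) (ι-* (ℤ.+ q) (ℤ.+ q))))) ⟨
      ι (e ℤ.* e ℤ.- ℤ.+ n ℤ.* (ℤ.+ q ℤ.* ℤ.+ q)) ∎
      where
      open ≡-Reasoning
      s : ℚ
      s = √-seq n m

  null-margin⇒√ : .{{_ : NonZero q}} → ∀ e e′ → Null (margin n h e) → ℤ.+ q ℤ.* e′ ℤ.+ e ≡ ℤ.0ℤ →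
                  n ≡ ℤ.∣ e′ ∣ * ℤ.∣ e′ ∣ × (∀ m → √-seq n m ≡ ι e′)
  null-margin⇒√ e e′ null-e qe′+e≡0 = n≡∣e′∣² , λ m → trans (√≡∣e′∣ m) (cong ι (sym e′≡∣e′∣))
    where
    instance
      +q-nonZero : ℤ.NonZero (ℤ.+ q)
      +q-nonZero = ℤ.≢-nonZero (ℕ.≢-nonZero⁻¹ q ∘ ℤ.+-injective)
    e≡-qe′ : e ≡ ℤ.- (ℤ.+ q ℤ.* e′)
    e≡-qe′ = i+j≡0⇒i≡-j e (ℤ.+ q ℤ.* e′) (trans (ℤ.+-comm e (ℤ.+ q ℤ.* e′)) qe′+e≡0)
    e′²≡n : e′ ℤ.* e′ ≡ ℤ.+ n
    e′²≡n = ℤ.*-cancelˡ-≡ (ℤ.+ q) (e′ ℤ.* e′) (ℤ.+ n) (ℤ.*-cancelˡ-≡ (ℤ.+ q) _ _ (begin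
      ℤ.+ q ℤ.* (ℤ.+ q ℤ.* (e′ ℤ.* e′))                    ≡⟨ square (ℤ.+ q) e′ ⟩
      ℤ.- (ℤ.+ q ℤ.* e′) ℤ.* ℤ.- (ℤ.+ q ℤ.* e′)            ≡⟨ cong (λ y → y ℤ.* y) e≡-qe′ ⟨
      e ℤ.* e                                              ≡⟨ null-margin⇒square e null-e ⟩
      ℤ.+ n ℤ.* (ℤ.+ q ℤ.* ℤ.+ q)                          ≡⟨ swap (ℤ.+ n) (ℤ.+ q) ⟩
      ℤ.+ q ℤ.* (ℤ.+ q ℤ.* ℤ.+ n)                          ∎))
      where
      open ≡-Reasoning
      square : ∀ q x → q ℤ.* (q ℤ.* (x ℤ.* x)) ≡ ℤ.- (q ℤ.* x) ℤ.* ℤ.- (q ℤ.* x)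
      square = ℤR.solve-∀
      swap : ∀ n q → n ℤ.* (q ℤ.* q) ≡ q ℤ.* (q ℤ.* n)
      swap = ℤR.solve-∀
    n≡∣e′∣² : n ≡ ℤ.∣ e′ ∣ * ℤ.∣ e′ ∣
    n≡∣e′∣² = ℤ.+-injective (trans (sym e′²≡n) (i*i≡+∣i∣² e′))
    √≡∣e′∣ : ∀ m → √-seq n m ≡ ι (ℤ.+ ℤ.∣ e′ ∣)
    √≡∣e′∣ m = trans (cong (λ n → √-seq n m) n≡∣e′∣²) (√-seq-square ℤ.∣ e′ ∣ m)
    e+q∣e′∣≡0 : e ℤ.+ ℤ.+ q ℤ.* ℤ.+ ℤ.∣ e′ ∣ ≡ ℤ.0ℤ
    e+q∣e′∣≡0 = ι-injective (null-const (null-cong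
      (λ m → begin
        ι (ℤ.+ h) ℚ.* margin n h e m                  ≡⟨ numerator e m ⟩
        ι e ℚ.+ Q ℚ.* √-seq n m                       ≡⟨ cong (λ s → ι e ℚ.+ Q ℚ.* s) (√≡∣e′∣ m) ⟩
        ι e ℚ.+ Q ℚ.* ι (ℤ.+ ℤ.∣ e′ ∣)                ≡⟨ cong (λ y → ι e ℚ.+ y) (ι-* (ℤ.+ q) (ℤ.+ ℤ.∣ e′ ∣)) ⟨
        ι e ℚ.+ ι (ℤ.+ q ℤ.* ℤ.+ ℤ.∣ e′ ∣)            ≡⟨ ι-+ e (ℤ.+ q ℤ.* ℤ.+ ℤ.∣ e′ ∣) ⟨
        ι (e ℤ.+ ℤ.+ q ℤ.* ℤ.+ ℤ.∣ e′ ∣)              ∎)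
      (null-ι* (ℤ.+ h) null-e)))
      where open ≡-Reasoning
    e′≡∣e′∣ : e′ ≡ ℤ.+ ℤ.∣ e′ ∣
    e′≡∣e′∣ = ℤ.*-cancelˡ-≡ (ℤ.+ q) e′ (ℤ.+ ℤ.∣ e′ ∣) (trans
      (i+j≡0⇒i≡-j (ℤ.+ q ℤ.* e′) e qe′+e≡0)
      (sym (i+j≡0⇒i≡-j (ℤ.+ q ℤ.* ℤ.+ ℤ.∣ e′ ∣) e (trans (ℤ.+-comm (ℤ.+ q ℤ.* ℤ.+ ℤ.∣ e′ ∣) e) e+q∣e′∣≡0))))

-- Perfect nonlinear functions

neg-square : ∀ i → i ℤ.* i ≡ ℤ.- i ℤ.* ℤ.- i
neg-square = ℤR.solve-∀

module _ {c ℓ} (G : FiniteGroup c ℓ) where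
  open FiniteGroup G
  open Group group using () renaming (sym to ≈-sym; trans to ≈-trans)
  open Inverse enumeration using (to; from; to-cong; from-cong; strictlyInverseˡ; strictlyInverseʳ)

  to-injective : ∀ {x y} → to x ≡ to y → x ≈ y
  to-injective {x} {y} eq = ≈-trans (≈-sym (strictlyInverseʳ x)) (≈-trans (from-cong eq) (strictlyInverseʳ y))

  another-element : 1 < order → ∀ x → ∃ λ y → ¬ y ≈ x
  another-element 1<n x with another-index 1<n (to x)
    where
    another-index : ∀ {n} → 1 < n → (i : Fin n) → ∃ λ j → j ≢ i
    another-index {suc (suc _)} _ zero    = suc zero , λ ()
    another-index {suc (suc _)} _ (suc i) = zero , λ ()
    another-index {suc zero} (ℕ.s≤s ()) _
  ... | j , j≢x = from j , λ y≈x → j≢x (trans (sym (strictlyInverseˡ j)) (to-cong y≈x))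

  distinct⇒1<order : ∀ {x y} → ¬ x ≈ y → 1 < order
  distinct⇒1<order {x} {y} x≉y = distinct-indices (x≉y ∘ to-injective)
    where
    distinct-indices : ∀ {n} {i j : Fin n} → i ≢ j → 1 < n
    distinct-indices {suc zero} {zero} {zero} i≢j = contradiction refl i≢j
    distinct-indices {suc (suc _)} _ = ℕ.s≤s (ℕ.s≤s ℕ.z≤n)

module _ {c₁ ℓ₁ c₂ ℓ₂} (G : FiniteGroup c₁ ℓ₁) (H : FiniteGroup c₂ ℓ₂)
         (F : Map G H) (perfect : PerfectNonlinear G H F) where
  private
    module G = FiniteGroup G
    module H where
      open FiniteGroup H public
      open Inverse enumeration public using (to; from; strictlyInverseʳ)
    n h q : ℕ
    n = G.order
    h = H.order
    q = pred h

    size : H.Carrier → ℕ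
    size = preimageSize G H F

  collisions-uniform : ∀ a → ¬ a G.≈ G.0# → h * collisions G H F a ≡ n
  collisions-uniform a a≉0 = ℤ.+-injective (trans (ℤ.pos-* h (collisions G H F a)) (ι-/ h (perfect a a≉0 H.0#)))

  dev : H.Carrier → ℤ
  dev β = deviation n h (size β)

  private
    d : Fin h → ℤ
    d j = dev (H.from j)

    d-to : ∀ β → d (H.to β) ≡ dev β
    d-to β = cong (deviation n h) (preimageSize-cong G H F (H.strictlyInverseʳ β))

    sum-d : sumℤ d ≡ ℤ.0ℤ
    sum-d = sum-deviation (fibre G H F) (sum-fibre G H F)

    sum-d² : sumℤ (λ j → d j ℤ.* d j) ≡ ℤ.+ h ℤ.* ℤ.+ n ℤ.* ℤ.+ q
    sum-d² = sum-deviation² (fibre G H F) (sum-fibre G H F) (sum-fibre²-uniform G H F collisions-uniform)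

  dev-bound : ∀ β → dev β ℤ.* dev β ℤ.≤ ℤ.+ n ℤ.* (ℤ.+ q ℤ.* ℤ.+ q)
  dev-bound β = subst (λ e → e ℤ.* e ℤ.≤ ℤ.+ n ℤ.* (ℤ.+ q ℤ.* ℤ.+ q)) (d-to β)
    (deviation-bound d n sum-d sum-d² (H.to β))

  dev-extremal : ∀ α → dev α ℤ.* dev α ≡ ℤ.+ n ℤ.* (ℤ.+ q ℤ.* ℤ.+ q) →
                 ∀ {β} → ¬ β H.≈ α → ℤ.+ q ℤ.* dev β ℤ.+ dev α ≡ ℤ.0ℤ
  dev-extremal α eq {β} β≉α = subst₂ (λ x y → ℤ.+ q ℤ.* x ℤ.+ y ≡ ℤ.0ℤ) (d-to β) (d-to α)
    (deviation-extremal d n sum-d sum-d² (H.to α)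
      (subst (λ e → e ℤ.* e ≡ ℤ.+ n ℤ.* (ℤ.+ q ℤ.* ℤ.+ q)) (sym (d-to α)) eq)
      (β≉α ∘ to-injective H ∘ sym))

  module _ {α β} (β≉α : ¬ β H.≈ α) where
    private
      instance
        q-nonZero : NonZero q
        q-nonZero = ℕ.>-nonZero (ℕ.pred-mono-≤ (distinct⇒1<order H β≉α))

    lower-attained : Null (margin n h (dev α)) → n ≡ ℤ.∣ dev β ∣ * ℤ.∣ dev β ∣ × (∀ m → √-seq n m ≡ ι (dev β))
    lower-attained null-α = null-margin⇒√ n h (dev α) (dev β) null-α
      (dev-extremal α (null-margin⇒square n h (dev α) null-α) β≉α)

    upper-attained : Null (margin n h (ℤ.- dev α)) →
      n ≡ ℤ.∣ ℤ.- dev β ∣ * ℤ.∣ ℤ.- dev β ∣ × (∀ m → √-seq n m ≡ ι (ℤ.- dev β))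
    upper-attained null-α = null-margin⇒√ n h (ℤ.- dev α) (ℤ.- dev β) null-α (begin
      ℤ.+ q ℤ.* ℤ.- dev β ℤ.+ ℤ.- dev α    ≡⟨ factor (ℤ.+ q) (dev β) (dev α) ⟩
      ℤ.- (ℤ.+ q ℤ.* dev β ℤ.+ dev α)      ≡⟨ cong ℤ.-_ (dev-extremal α (trans (neg-square (dev α)) (null-margin⇒square n h (ℤ.- dev α) null-α)) β≉α) ⟩
      ℤ.0ℤ                                 ∎)
      where
      open ≡-Reasoning
      factor : ∀ q b a → q ℤ.* ℤ.- b ℤ.+ ℤ.- a ≡ ℤ.- (q ℤ.* b ℤ.+ a)
      factor = ℤR.solve-∀

  module _ (β : H.Carrier) {g} (hg≡n : h * g ≡ n) where
    ∣dev∣-multiple : ℤ.∣ dev β ∣ ≡ ℤ.∣ ℤ.+ size β ℤ.- ℤ.+ g ∣ * h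
    ∣dev∣-multiple = begin
      ℤ.∣ ℤ.+ h ℤ.* ℤ.+ size β ℤ.- ℤ.+ n ∣                 ≡⟨ cong (λ n → ℤ.∣ ℤ.+ h ℤ.* ℤ.+ size β ℤ.- n ∣) (trans (cong ℤ.+_ (sym hg≡n)) (ℤ.pos-* h g)) ⟩
      ℤ.∣ ℤ.+ h ℤ.* ℤ.+ size β ℤ.- ℤ.+ h ℤ.* ℤ.+ g ∣       ≡⟨ cong ℤ.∣_∣ (factor (ℤ.+ h) (ℤ.+ size β) (ℤ.+ g)) ⟩
      ℤ.∣ (ℤ.+ size β ℤ.- ℤ.+ g) ℤ.* ℤ.+ h ∣               ≡⟨ ℤ.abs-* (ℤ.+ size β ℤ.- ℤ.+ g) (ℤ.+ h) ⟩
      ℤ.∣ ℤ.+ size β ℤ.- ℤ.+ g ∣ * h                       ∎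
      where
      open ≡-Reasoning
      factor : ∀ h k g → h ℤ.* k ℤ.- h ℤ.* g ≡ (k ℤ.- g) ℤ.* h
      factor = ℤR.solve-∀

    √-multiple : n ≡ ℤ.∣ dev β ∣ * ℤ.∣ dev β ∣ →
                 ∃ (λ k → √ n ≃ᵣ fromℕ (k * h)) × ∃ (λ m → n ≡ m * m)
    √-multiple n≡∣dev∣² =
      (ℤ.∣ ℤ.+ size β ℤ.- ℤ.+ g ∣ , ≃ᵣ-pointwise {√ n} {fromℕ (ℤ.∣ ℤ.+ size β ℤ.- ℤ.+ g ∣ * h)} λ m →
        trans (cong (ℚ._- ι (ℤ.+ (ℤ.∣ ℤ.+ size β ℤ.- ℤ.+ g ∣ * h)))
          (trans (cong (λ n → √-seq n m) n≡∣dev∣²) (trans (√-seq-square ℤ.∣ dev β ∣ m) (cong (ι ∘ ℤ.+_) ∣dev∣-multiple))))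
        (ℚ.+-inverseʳ (ι (ℤ.+ (ℤ.∣ ℤ.+ size β ℤ.- ℤ.+ g ∣ * h))))) ,
      ℤ.∣ dev β ∣ , n≡∣dev∣²

theorem2p4 : ∀ {c₁ ℓ₁ c₂ ℓ₂} (G : FiniteGroup c₁ ℓ₁) (H : FiniteGroup c₂ ℓ₂) →
    let module G = FiniteGroup G
        module H = FiniteGroup H
        ∣G∣ = fromℕ G.order
        √∣G∣ = √ G.order
        h = H.order
    in
    (F : Map G H) → PerfectNonlinear G H F →
    let ∣F⁻¹_∣ = λ (β : H.Carrier) → fromℕ (preimageSize G H F β)
        lower = ∣G∣ /ᵣ h -ᵣ √∣G∣ +ᵣ √∣G∣ /ᵣ h
        upper = ∣G∣ /ᵣ h +ᵣ √∣G∣ -ᵣ √∣G∣ /ᵣ h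
    in
    (∀ β → lower ≤ᵣ ∣F⁻¹ β ∣ × ∣F⁻¹ β ∣ ≤ᵣ upper)
    ×
    (∀ α → ∣F⁻¹ α ∣ ≃ᵣ lower →
     ∀ β → ¬ β H.≈ α → ∣F⁻¹ β ∣ ≃ᵣ ∣G∣ /ᵣ h +ᵣ √∣G∣ /ᵣ h)
    ×
    (∀ α → ∣F⁻¹ α ∣ ≃ᵣ upper →
     ∀ β → ¬ β H.≈ α → ∣F⁻¹ β ∣ ≃ᵣ ∣G∣ /ᵣ h -ᵣ √∣G∣ /ᵣ h)
    ×
    (1 < G.order → 1 < H.order →
     ∃ (λ α → ∣F⁻¹ α ∣ ≃ᵣ lower ⊎ ∣F⁻¹ α ∣ ≃ᵣ upper) →
     ∃ (λ (k : ℕ) → √∣G∣ ≃ᵣ fromℕ (k * h)) × ∃ (λ (m : ℕ) → G.order ≡ m * m))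
theorem2p4 G H F perfect = bounds , at-lower , at-upper , divisibility
  where
  module G = FiniteGroup G
  module H = FiniteGroup H
  n h : ℕ
  n = G.order
  h = H.order
  c : ℚ
  c = recip h
  size : H.Carrier → ℕ
  size = preimageSize G H F
  δ : H.Carrier → ℤ
  δ = dev G H F perfect
  lower upper : ℝ
  lower = fromℕ n /ᵣ h -ᵣ √ n +ᵣ √ n /ᵣ h
  upper = fromℕ n /ᵣ h +ᵣ √ n -ᵣ √ n /ᵣ h

  bounds : ∀ β → lower ≤ᵣ fromℕ (size β) × fromℕ (size β) ≤ᵣ upper
  bounds β =
    ≤ᵣ-intro {lower} {fromℕ (size β)} (λ m → subst (λ x → 0ℚ ℚ.≤ x ℚ.+ recip (suc m)) (sym (margin-lower n h (size β) m))
      (0≤margin+recip n h (δ β) (dev-bound G H F perfect β) m)) ,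
    ≤ᵣ-intro {fromℕ (size β)} {upper} (λ m → subst (λ x → 0ℚ ℚ.≤ x ℚ.+ recip (suc m)) (sym (margin-upper n h (size β) m))
      (0≤margin+recip n h (ℤ.- δ β)
        (subst (ℤ._≤ ℤ.+ n ℤ.* (ℤ.+ pred h ℤ.* ℤ.+ pred h)) (neg-square (δ β)) (dev-bound G H F perfect β)) m))

  null-lower : ∀ α → fromℕ (size α) ≃ᵣ lower → Null (margin n h (δ α))
  null-lower α = null-cong (margin-lower n h (size α))

  null-upper : ∀ α → fromℕ (size α) ≃ᵣ upper → Null (margin n h (ℤ.- δ α))
  null-upper α eq = null-cong
    (λ m → trans (flip (ι (ℤ.+ size α)) (seq upper m)) (margin-upper n h (size α) m)) (null-neg eq)
    where
    flip : ∀ x y → ℚ.- (x ℚ.- y) ≡ y ℚ.- x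
    flip = solve 2 (λ x y → :- (x :- y) := y :- x) refl

  at-lower : ∀ α → fromℕ (size α) ≃ᵣ lower →
             ∀ β → ¬ β H.≈ α → fromℕ (size β) ≃ᵣ fromℕ n /ᵣ h +ᵣ √ n /ᵣ h
  at-lower α eq β β≉α = ≃ᵣ-pointwise {fromℕ (size β)} {fromℕ n /ᵣ h +ᵣ √ n /ᵣ h} λ m →
    centred-deviation n h (size β) (√-seq n m) (sym (proj₂ (lower-attained G H F perfect β≉α (null-lower α eq)) m))

  at-upper : ∀ α → fromℕ (size α) ≃ᵣ upper →
             ∀ β → ¬ β H.≈ α → fromℕ (size β) ≃ᵣ fromℕ n /ᵣ h -ᵣ √ n /ᵣ h
  at-upper α eq β β≉α = ≃ᵣ-pointwise {fromℕ (size β)} {fromℕ n /ᵣ h -ᵣ √ n /ᵣ h} λ m → trans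
    (cong (λ y → ι (ℤ.+ size β) ℚ.- (ι (ℤ.+ n) ℚ.* c ℚ.+ y)) (ℚ.neg-distribˡ-* (√-seq n m) c))
    (centred-deviation n h (size β) (ℚ.- √-seq n m) (begin
      ι (δ β)                      ≡⟨ cong ι (ℤ.neg-involutive (δ β)) ⟨
      ι (ℤ.- (ℤ.- δ β))            ≡⟨ ι-neg (ℤ.- δ β) ⟩
      ℚ.- ι (ℤ.- δ β)              ≡⟨ cong ℚ.-_ (proj₂ (upper-attained G H F perfect β≉α (null-upper α eq)) m) ⟨
      ℚ.- √-seq n m                ∎))
    where open ≡-Reasoning

  divisibility : 1 < n → 1 < h →
    ∃ (λ α → fromℕ (size α) ≃ᵣ lower ⊎ fromℕ (size α) ≃ᵣ upper) →
    ∃ (λ k → √ n ≃ᵣ fromℕ (k * h)) × ∃ (λ m → n ≡ m * m)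
  divisibility 1<n 1<h (α , attained) =
    let a , a≉0 = another-element G 1<n G.0#
        β , β≉α = another-element H 1<h α
    in √-multiple G H F perfect β (collisions-uniform G H F perfect a a≉0) (square β≉α attained)
    where
    square : ∀ {β} → ¬ β H.≈ α → fromℕ (size α) ≃ᵣ lower ⊎ fromℕ (size α) ≃ᵣ upper → n ≡ ℤ.∣ δ β ∣ * ℤ.∣ δ β ∣
    square β≉α (inj₁ eq) = proj₁ (lower-attained G H F perfect β≉α (null-lower α eq))
    square {β} β≉α (inj₂ eq) = trans (proj₁ (upper-attained G H F perfect β≉α (null-upper α eq)))
      (cong₂ _*_ (ℤ.∣-i∣≡∣i∣ (δ β)) (ℤ.∣-i∣≡∣i∣ (δ β)))
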